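{- Let $e,m$ be integers with $3\leq e<m$. If $m-e\leq 6$, then $\mathscr{R}(e,m)=\mathscr{C}(e,m)$.
   Context: A numerical monoid is an additive submonoid $\Gamma\subseteq\mathbb{N}$ (containing $0$) with $\mathbb{N}\setminus\Gamma$ finite. It has a unique minimal set of generators $g_0<g_1<\cdots<g_e$; its embedding dimension is $\mathrm{edim}(\Gamma)=e+1$ and its multiplicity is $\mathrm{mult}(\Gamma)=g_0$. Let $\varphi:\mathbb{N}^{e+1}\to\mathbb{N}$, $\varphi(a_0,\dots,a_e)=\sum_i a_ig_i$, and let $\ker\varphi=\{(\mathbf a,\mathbf b): \varphi(\mathbf a)=\varphi(\mathbf b)\}$ (a congruence on $\mathbb{N}^{e+1}$). The number of minimal relations $\rho(\Gamma)$ is the cardinality of a minimal generating set of the congruence $\ker\varphi$ (independent of the choice). Define $\mathscr{R}(e,m)=\max\{\rho(\Gamma): \mathrm{edim}(\Gamma)=e+1,\ \mathrm{mult}(\Gamma)=m\}$. For positive integers $n,d$ write the Macaulay expansion $n=\binom{n_d}{d}+\cdots+\binom{n_j}{j}$ with uniquely determined integers $n_d>n_{d-1}>\cdots>n_j\geq j\geq 1$, and set $n^{\langle d\rangle}=\binom{n_d+1}{d+1}+\cdots+\binom{n_j+1}{j+1}$; set $0^{\langle d\rangle}=0$. For integers $1<e<m$, let $r$ be the unique integer with $\binom{e+r-1}{r-1}\leq m<\binom{e+r}{r}$, let $s=m-\binom{e+r-1}{r-1}$, and define $\mathscr{C}(e,m)=\binom{e+r-1}{r}+s^{\langle r\rangle}-s$.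 -}

module Defs where

open import Data.Nat using (ℕ; zero; suc; _+_; _*_; _∸_; _≤_; _<_)
open import Data.Nat.Combinatorics using (_C_)
open import Data.Fin using (Fin) renaming (_<_ to _<ᶠ_)
open import Data.Vec using (Vec; lookup; zipWith; head)
open import Data.List using (List; []; _∷_; length; sum)
open import Data.List.Membership.Propositional using (_∈_)
open import Data.List.Relation.Unary.All using (All)
open import Data.Product using (_×_; _,_; ∃; proj₁; proj₂)
open import Data.Unit using (⊤)
open import Relation.Nullary using (¬_)
open import Relation.Binary.PropositionalEquality using (_≡_)

-- Numerical monoids given by their minimal system of generators
-- g = (g_0, ..., g_e) : Vec ℕ k  with k = e + 1.

φ : ∀ {k} → Vec ℕ k → Vec ℕ k → ℕ
φ g a = Data.Vec.sum (zipWith _*_ a g)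

_∈⟨_⟩ : ∀ {k} → ℕ → Vec ℕ k → Set
n ∈⟨ g ⟩ = ∃ λ a → φ g a ≡ n

IsMinGenNumMonoid : ∀ {k} → Vec ℕ k → Set
IsMinGenNumMonoid {k} g =
    (∀ (i j : Fin k) → i <ᶠ j → lookup g i < lookup g j)
  × (∀ (i : Fin k) → ¬ (∃ λ a → lookup a i ≡ 0 × φ g a ≡ lookup g i))
  × (∃ λ N → ∀ n → N ≤ n → n ∈⟨ g ⟩)

_⊕_ : ∀ {k} → Vec ℕ k → Vec ℕ k → Vec ℕ k
a ⊕ b = zipWith _+_ a b

data Gen {k} (R : List (Vec ℕ k × Vec ℕ k)) : Vec ℕ k → Vec ℕ k → Set where
  base  : ∀ {a b} → (a , b) ∈ R → Gen R a b
  refl  : ∀ {a} → Gen R a a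
  sym   : ∀ {a b} → Gen R a b → Gen R b a
  trans : ∀ {a b c} → Gen R a b → Gen R b c → Gen R a c
  add   : ∀ {a b} → Gen R a b → (c : Vec ℕ k) → Gen R (a ⊕ c) (b ⊕ c)

IsPresentation : ∀ {k} → Vec ℕ k → List (Vec ℕ k × Vec ℕ k) → Set
IsPresentation g R =
    All (λ p → φ g (proj₁ p) ≡ φ g (proj₂ p)) R
  × (∀ a b → φ g a ≡ φ g b → Gen R a b)

HasRho : ∀ {k} → Vec ℕ k → ℕ → Set
HasRho g n =
    (∃ λ R → IsPresentation g R × length R ≡ n)
  × (∀ R → IsPresentation g R → n ≤ length R)

-- ℛ(e,m) = c : c is the maximum of ρ(Γ) over numerical monoids Γ with
-- edim(Γ) = e+1 and mult(Γ) = m.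
IsMaxRho : ℕ → ℕ → ℕ → Set
IsMaxRho e m c =
    (∃ λ (g : Vec ℕ (suc e)) → IsMinGenNumMonoid g × head g ≡ m × HasRho g c)
  × (∀ (g : Vec ℕ (suc e)) → IsMinGenNumMonoid g → head g ≡ m →
       ∀ n → HasRho g n → n ≤ c)

-- Macaulay expansions.  A list [n_d, n_{d-1}, …, n_j] attached to degree d.

DecHead : ℕ → List ℕ → Set
DecHead x []      = ⊤
DecHead x (y ∷ _) = y < x

ValidMac : ℕ → List ℕ → Set
ValidMac d []       = ⊤
ValidMac d (x ∷ xs) = 1 ≤ d × d ≤ x × DecHead x xs × ValidMac (d ∸ 1) xs

macVal : ℕ → List ℕ → ℕ
macVal d []       = 0
macVal d (x ∷ xs) = x C d + macVal (d ∸ 1) xs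

macUp : ℕ → List ℕ → ℕ
macUp d []       = 0
macUp d (x ∷ xs) = suc x C suc d + macUp (d ∸ 1) xs

-- n^⟨d⟩ = v   (for n = 0 the empty expansion gives 0^⟨d⟩ = 0)
MacUp : ℕ → ℕ → ℕ → Set
MacUp d n v = ∃ λ xs → ValidMac d xs × macVal d xs ≡ n × macUp d xs ≡ v

{-# OPTIONS --safe #-}
-- Necessarily r = 2, and s = m − e − 1 ≤ 5.
--
-- Upper bound.  Order the factorizations of an element by the exponent of the multiplicity and then
-- lexicographically.  The optimal factorizations without the multiplicity form an order ideal B of
-- monomials in e variables.  Elements of B are distinct modulo m, so |B| ≤ m and at most s of them
-- have degree ≥ 2.  One relation per minimal monomial outside B presents the monoid, and
-- Macaulay's bound, proved here by induction on the number of variables for at most 5 monomials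
-- of degree ≥ 2, limits their number.
--
-- Lower bound.  Call a factorization isolated if its proper divisors are unique factorizations.
-- Isolated vectors without the multiplicity, whose value also has a factorization with it, must be
-- linked by a presentation to vectors outside their set, as in a forest, so their number is a
-- lower bound.  The extremal monoids have few small generators m + O with prescribed pairwise sums,
-- almost all other generators lying in an interval; the case e = 3, m = 8 needs a separate monoid.
module Submission where

open import Defs
open import Data.Bool using (true; false)
open import Data.Fin as Fin using (Fin; zero; suc; _↑ˡ_; _↑ʳ_; splitAt)
import Data.Fin.Properties as Fin
open import Data.List as List using (List; []; _∷_; length; filter; _++_; map; allFin; upTo; cartesianProductWith)
import Data.List.Membership.DecPropositional as DecMembership
open import Data.List.Membership.Propositional using (_∈_; _∉_; find; lose)
open import Data.List.Membership.Propositional.Properties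
import Data.List.Properties as List
open import Data.List.Relation.Unary.All as All using (All; [])
import Data.List.Relation.Unary.All.Properties as All
import Data.List.Relation.Unary.AllPairs as AllPairs
open import Data.List.Relation.Unary.AllPairs using ([]; _∷_)
open import Data.List.Relation.Unary.Any as Any using (here; there; _─_)
open import Data.List.Relation.Unary.Unique.DecPropositional using (unique?)
open import Data.List.Relation.Unary.Unique.Propositional using (Unique)
import Data.List.Relation.Unary.Unique.Propositional.Properties as Unique
open import Data.Nat
open import Data.Nat.Combinatorics using (_C_; nC1≡n; nCk+nC[k+1]≡[n+1]C[k+1])
open import Data.Nat.DivMod using (_/_; _%_; m≡m%n+[m/n]*n; m%n<n)
open import Data.Nat.Induction using (<-wellFounded)
open import Data.Nat.Properties
open import Data.Nat.Tactic.RingSolver using (solve-∀)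
open import Data.Product using (_×_; _,_; ∃; ∃₂; proj₁; proj₂)
open import Data.Sum using (_⊎_; inj₁; inj₂)
open import Data.Unit using (⊤; tt)
open import Data.Vec as Vec using (Vec; []; _∷_; lookup; replicate; zipWith; _[_]%=_) renaming (_++_ to _++ᵛ_)
import Data.Vec.Properties as Vec
open import Data.Vec.Relation.Binary.Lex.Strict as Lex using (Lex-<; this; next)
open import Data.Vec.Relation.Binary.Pointwise.Inductive using (Pointwise-≡⇒≡; ≡⇒Pointwise-≡)
open import Function using (_∘_)
open import Induction.WellFounded using (WellFounded; Acc; acc)
open import Level using (0ℓ)
open import Relation.Binary using (DecidableEquality; tri<; tri≈; tri>)
open import Relation.Binary.PropositionalEquality as ≡ using (_≡_; _≢_; refl; cong; cong₂; subst)
open import Relation.Nullary using (¬_; Dec; yes; no; does; contradiction; ¬?)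
open import Relation.Nullary.Decidable using (from-yes; map′; _→-dec_; _×-dec_; _⊎-dec_)
open import Relation.Unary using (Pred; Decidable)

private variable
  k l : ℕ

-- Exponent vectors

infix 4 _≟ᵛ_

_≟ᵛ_ : DecidableEquality (Vec ℕ k)
_≟ᵛ_ = Vec.≡-dec _≟_

deg : Vec ℕ k → ℕ
deg = Vec.sum

𝟎 : Vec ℕ k
𝟎 = replicate _ 0

at : Fin k → ℕ → Vec ℕ k
at zero    x = x ∷ 𝟎
at (suc i) x = 0 ∷ at i x

unit : Fin k → Vec ℕ k
unit i = at i 1

⊕-comm : ∀ (a b : Vec ℕ k) → a ⊕ b ≡ b ⊕ a
⊕-comm = Vec.zipWith-comm +-comm

⊕-assoc : ∀ (a b c : Vec ℕ k) → (a ⊕ b) ⊕ c ≡ a ⊕ (b ⊕ c)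
⊕-assoc = Vec.zipWith-assoc +-assoc

⊕-identityˡ : ∀ (a : Vec ℕ k) → 𝟎 ⊕ a ≡ a
⊕-identityˡ = Vec.zipWith-identityˡ +-identityˡ

⊕-identityʳ : ∀ (a : Vec ℕ k) → a ⊕ 𝟎 ≡ a
⊕-identityʳ = Vec.zipWith-identityʳ +-identityʳ

⊕-swap : ∀ (a b c : Vec ℕ k) → a ⊕ (b ⊕ c) ≡ b ⊕ (a ⊕ c)
⊕-swap a b c = ≡.trans (≡.sym (⊕-assoc a b c)) (≡.trans (cong (_⊕ c) (⊕-comm a b)) (⊕-assoc b a c))

⊕-cancelˡ : ∀ (a b c : Vec ℕ k) → a ⊕ b ≡ a ⊕ c → b ≡ c
⊕-cancelˡ []      []      []      eq = refl
⊕-cancelˡ (x ∷ a) (y ∷ b) (z ∷ c) eq =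
  cong₂ _∷_ (+-cancelˡ-≡ x y z (Vec.∷-injectiveˡ eq)) (⊕-cancelˡ a b c (Vec.∷-injectiveʳ eq))

deg-⊕ : ∀ (a b : Vec ℕ k) → deg (a ⊕ b) ≡ deg a + deg b
deg-⊕ []      []      = refl
deg-⊕ (x ∷ a) (y ∷ b) = ≡.trans (cong (x + y +_) (deg-⊕ a b)) (lemma x y (deg a) (deg b))
  where
  lemma : ∀ x y p q → x + y + (p + q) ≡ x + p + (y + q)
  lemma = solve-∀

deg-𝟎 : ∀ k → deg (𝟎 {k}) ≡ 0
deg-𝟎 zero    = refl
deg-𝟎 (suc k) = deg-𝟎 k

deg-at : ∀ (i : Fin k) x → deg (at i x) ≡ x
deg-at {suc k} zero    x = ≡.trans (cong (x +_) (deg-𝟎 k)) (+-identityʳ x)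
deg-at         (suc i) x = deg-at i x

deg-unit⊕ : ∀ i (a : Vec ℕ k) → deg (unit i ⊕ a) ≡ suc (deg a)
deg-unit⊕ i a = ≡.trans (deg-⊕ (unit i) a) (cong (_+ deg a) (deg-at i 1))

φ-⊕ : ∀ (g a b : Vec ℕ k) → φ g (a ⊕ b) ≡ φ g a + φ g b
φ-⊕ []      []      []      = refl
φ-⊕ (x ∷ g) (y ∷ a) (z ∷ b) = ≡.trans (cong ((y + z) * x +_) (φ-⊕ g a b)) (lemma x y z (φ g a) (φ g b))
  where
  lemma : ∀ x y z p q → (y + z) * x + (p + q) ≡ y * x + p + (z * x + q)
  lemma = solve-∀

φ-𝟎 : ∀ (g : Vec ℕ k) → φ g 𝟎 ≡ 0
φ-𝟎 []      = refl
φ-𝟎 (x ∷ g) = φ-𝟎 g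

φ-at : ∀ (g : Vec ℕ k) i x → φ g (at i x) ≡ x * lookup g i
φ-at (y ∷ g) zero    x = ≡.trans (cong (x * y +_) (φ-𝟎 g)) (+-identityʳ (x * y))
φ-at (y ∷ g) (suc i) x = φ-at g i x

φ-unit : ∀ (g : Vec ℕ k) i → φ g (unit i) ≡ lookup g i
φ-unit g i = ≡.trans (φ-at g i 1) (*-identityˡ (lookup g i))

φ-unit⊕ : ∀ (g : Vec ℕ k) i a → φ g (unit i ⊕ a) ≡ lookup g i + φ g a
φ-unit⊕ g i a = ≡.trans (φ-⊕ g (unit i) a) (cong (_+ φ g a) (φ-unit g i))

lookup-⊕ : ∀ i (a b : Vec ℕ k) → lookup (a ⊕ b) i ≡ lookup a i + lookup b i
lookup-⊕ i a b = Vec.lookup-zipWith _+_ i a b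

lookup-at : ∀ (i : Fin k) x → lookup (at i x) i ≡ x
lookup-at zero    x = refl
lookup-at (suc i) x = lookup-at i x

lookup-at-≢ : ∀ {i j : Fin k} x → i ≢ j → lookup (at i x) j ≡ 0
lookup-at-≢ {i = zero}  {zero}  x i≢j = contradiction refl i≢j
lookup-at-≢ {i = zero}  {suc j} x i≢j = Vec.lookup-replicate j 0
lookup-at-≢ {i = suc i} {zero}  x i≢j = refl
lookup-at-≢ {i = suc i} {suc j} x i≢j = lookup-at-≢ x (i≢j ∘ cong suc)

unit-injective : ∀ {i j : Fin k} → unit i ≡ unit j → i ≡ j
unit-injective {i = zero}  {zero}  eq = refl
unit-injective {i = suc i} {suc j} eq = cong suc (unit-injective (Vec.∷-injectiveʳ eq))

at-split : ∀ i x (a : Vec ℕ k) → x ≤ lookup a i → ∃ λ b → a ≡ at i x ⊕ b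
at-split zero    x (y ∷ a) x≤y = (y ∸ x ∷ a) , cong₂ _∷_ (≡.sym (m+[n∸m]≡n x≤y)) (≡.sym (⊕-identityˡ a))
at-split (suc i) x (y ∷ a) x≤a with b , a≡ ← at-split i x a x≤a = (y ∷ b) , cong (y ∷_) a≡

-- Distinct variables are coprime, so each divides the cofactor of the other, with a common quotient
-- `c`.
unit⊕-cancel : ∀ i j (a b : Vec ℕ k) → unit i ⊕ a ≡ unit j ⊕ b →
               (i ≡ j × a ≡ b) ⊎ ∃ λ c → b ≡ unit i ⊕ c × a ≡ unit j ⊕ c
unit⊕-cancel zero    zero    (x ∷ a) (y ∷ b) eq = inj₁ (refl , ⊕-cancelˡ (unit zero) (x ∷ a) (y ∷ b) eq)
unit⊕-cancel zero    (suc j) (x ∷ a) (y ∷ b) eq = inj₂ ((x ∷ b)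
  , cong₂ _∷_ (≡.sym (Vec.∷-injectiveˡ eq)) (≡.sym (⊕-identityˡ b))
  , cong (x ∷_) (≡.trans (≡.sym (⊕-identityˡ a)) (Vec.∷-injectiveʳ eq)))
unit⊕-cancel (suc i) zero    (x ∷ a) (y ∷ b) eq = inj₂ ((y ∷ a)
  , cong (y ∷_) (≡.trans (≡.sym (⊕-identityˡ b)) (≡.sym (Vec.∷-injectiveʳ eq)))
  , cong₂ _∷_ (Vec.∷-injectiveˡ eq) (≡.sym (⊕-identityˡ a)))
unit⊕-cancel (suc i) (suc j) (x ∷ a) (y ∷ b) eq with Vec.∷-injectiveˡ eq | unit⊕-cancel i j a b (Vec.∷-injectiveʳ eq)
... | refl | inj₁ (refl , refl)     = inj₁ (refl , refl)
... | refl | inj₂ (c , refl , refl) = inj₂ ((x ∷ c) , refl , refl)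

deg≡0 : ∀ (a : Vec ℕ k) → deg a ≡ 0 → a ≡ 𝟎
deg≡0 []         eq = refl
deg≡0 (zero ∷ a) eq = cong (0 ∷_) (deg≡0 a eq)

deg≥1 : ∀ (a : Vec ℕ k) → 1 ≤ deg a → ∃₂ λ i b → a ≡ unit i ⊕ b
deg≥1 (suc x ∷ a) _ = zero , (x ∷ a) , cong (suc x ∷_) (≡.sym (⊕-identityˡ a))
deg≥1 (zero  ∷ a) p with i , b , a≡ ← deg≥1 a p = suc i , (0 ∷ b) , cong (0 ∷_) a≡

deg≡1 : ∀ (a : Vec ℕ k) → deg a ≡ 1 → ∃ λ i → a ≡ unit i
deg≡1 a eq with i , b , refl ← deg≥1 a (≤-reflexive (≡.sym eq)) =
  i , ≡.trans (cong (unit i ⊕_) (deg≡0 b (suc-injective (≡.trans (≡.sym (deg-unit⊕ i b)) eq)))) (⊕-identityʳ (unit i))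

deg≡2 : ∀ (a : Vec ℕ k) → deg a ≡ 2 → ∃₂ λ i j → a ≡ unit i ⊕ unit j
deg≡2 a eq with i , b , refl ← deg≥1 a (≤-trans (s≤s z≤n) (≤-reflexive (≡.sym eq)))
           with j , refl ← deg≡1 b (suc-injective (≡.trans (≡.sym (deg-unit⊕ i b)) eq)) = i , j , refl

deg*≤φ : ∀ (g : Vec ℕ k) m → (∀ i → m ≤ lookup g i) → ∀ a → deg a * m ≤ φ g a
deg*≤φ []      m m≤ []      = z≤n
deg*≤φ (y ∷ g) m m≤ (x ∷ a) = begin
  (x + deg a) * m      ≡⟨ *-distribʳ-+ m x (deg a) ⟩
  x * m + deg a * m    ≤⟨ +-mono-≤ (*-monoʳ-≤ x (m≤ zero)) (deg*≤φ g m (m≤ ∘ suc) a) ⟩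
  x * y + φ g a        ∎
  where open ≤-Reasoning

-- Positive generators bound every exponent by `n`, so the search is finite. The predicate `P`
-- expresses a smaller key in `reducible?` and the various checks on the sporadic monoid.
factorization? : ∀ (g : Vec ℕ k) → (∀ i → 1 ≤ lookup g i) → ∀ {P : Pred (Vec ℕ k) 0ℓ} → Decidable P →
                 ∀ n → Dec (∃ λ a → φ g a ≡ n × P a)
factorization? [] pos P? zero with P? []
... | yes p = yes ([] , refl , p)
... | no ¬p = no λ where ([] , _ , p) → ¬p p
factorization? [] pos P? (suc n) = no λ where ([] , () , _)
factorization? (y ∷ g) pos {P} P? n with anyUpTo? first? (suc n)
  where
  First : ℕ → Set
  First x = x * y ≤ n × ∃ λ a → φ g a ≡ n ∸ x * y × P (x ∷ a)
  first? : Decidable First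
  first? x with x * y ≤? n
  ... | no ≰ = no λ (≤ , _) → ≰ ≤
  ... | yes ≤ with factorization? g (pos ∘ suc) (λ a → P? (x ∷ a)) (n ∸ x * y)
  ...   | yes q = yes (≤ , q)
  ...   | no ¬q = no λ (_ , q) → ¬q q
... | yes (x , _ , xy≤n , a , eq , p) = yes (x ∷ a , ≡.trans (cong (x * y +_) eq) (m+[n∸m]≡n xy≤n) , p)
... | no none = no λ where
  (x ∷ a , eq , p) → none
    ( x
    , s≤s (≤-trans (m≤m*n x y ⦃ >-nonZero (pos zero) ⦄) (≤-trans (m≤m+n (x * y) (φ g a)) (≤-reflexive eq)))
    , ≤-trans (m≤m+n (x * y) (φ g a)) (≤-reflexive eq)
    , a
    , ≡.trans (≡.sym (m+n∸m≡n (x * y) (φ g a))) (cong (_∸ x * y) eq)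
    , p)

-- Counting in lists

module _ {A : Set} where

  length-map-allFin : ∀ k {f : Fin k → A} → length (map f (allFin k)) ≡ k
  length-map-allFin k = ≡.trans (List.length-map _ (allFin k)) (List.length-tabulate {n = k} (λ i → i))

  length-filter+ : ∀ {P : Pred A 0ℓ} (P? : Decidable P) xs →
                   length (filter P? xs) + length (filter (¬? ∘ P?) xs) ≡ length xs
  length-filter+ P? [] = refl
  length-filter+ P? (x ∷ xs) with does (P? x)
  ... | true  = cong suc (length-filter+ P? xs)
  ... | false = ≡.trans (+-suc _ _) (cong suc (length-filter+ P? xs))

  length-─ : ∀ {x : A} {xs} (x∈ : x ∈ xs) → suc (length (xs ─ x∈)) ≡ length xs
  length-─ (here _)   = refl
  length-─ (there x∈) = cong suc (length-─ x∈)

  ∈-─⁺ : ∀ {x y : A} {xs} (x∈ : x ∈ xs) → y ≢ x → y ∈ xs → y ∈ (xs ─ x∈)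
  ∈-─⁺ (here refl) y≢x (here refl) = contradiction refl y≢x
  ∈-─⁺ (here refl) y≢x (there y∈)  = y∈
  ∈-─⁺ (there x∈)  y≢x (here refl) = here refl
  ∈-─⁺ (there x∈)  y≢x (there y∈)  = there (∈-─⁺ x∈ y≢x y∈)

  length-⊆ : ∀ {xs ys : List A} → Unique xs → (∀ {x} → x ∈ xs → x ∈ ys) → length xs ≤ length ys
  length-⊆ {[]}     _            _     = z≤n
  length-⊆ {x ∷ xs} u xs⊆ys = ≤-trans
    (s≤s (length-⊆ (AllPairs.tail u) λ y∈ →
      ∈-─⁺ (xs⊆ys (here refl)) (λ where refl → Unique.Unique[x∷xs]⇒x∉xs u y∈) (xs⊆ys (there y∈))))
    (≤-reflexive (length-─ (xs⊆ys (here refl))))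

  -- Counts what is left of a cover once its known members are removed; in `small-presentation` the
  -- cover comes from `bordered-cover` and the standard monomials are removed.
  length-filter-∉ : ∀ {P : Pred A 0ℓ} (P? : Decidable P) {xs ys : List A} → Unique xs →
                    (∀ {x} → x ∈ xs → x ∈ ys × P x) →
                    length xs + length (filter (¬? ∘ P?) ys) ≤ length ys
  length-filter-∉ P? {xs} {ys} u xs⊆ = ≤-trans
    (+-monoˡ-≤ _ (length-⊆ u λ x∈ → ∈-filter⁺ P? (proj₁ (xs⊆ x∈)) (proj₂ (xs⊆ x∈))))
    (≤-reflexive (length-filter+ P? ys))

-- Macaulay's bound

-- F s = s^⟨2⟩ for s ≤ 5.
F : ℕ → ℕ
F 0 = 0
F 1 = 1
F 2 = 2
F 3 = 4
F 4 = 5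
F _ = 7

-- With s elements of U free of the first variable and t divisible by it, there are at most s + t
-- bordered monomials of degree ≥ 3 divisible by the first variable (divide by that variable),
-- and also at most t + t(t-1)/2 (see determined).
newBound : ℕ → ℕ → ℕ
newBound zero      t = t
newBound s@(suc _) 0 = 0
newBound s@(suc _) 1 = 1
newBound s@(suc _) 2 = 3
newBound s@(suc _) t = s + t

-- Drives the induction on the number of variables in `bordered-cover`. Finitely many pairs are
-- involved, so evaluating a table decides it.
F-newBound : ∀ s t → s + t ≤ 5 → F s + newBound s t ≤ F (s + t)
F-newBound s t s+t≤5 = table (s≤s (≤-trans (m≤m+n s t) s+t≤5)) (s≤s (≤-trans (m≤n+m t s) s+t≤5)) s+t≤5
  where
  table : ∀ {s} → s < 6 → ∀ {t} → t < 6 → s + t ≤ 5 → F s + newBound s t ≤ F (s + t)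
  table = from-yes (allUpTo? (λ s → allUpTo? (λ t → (s + t ≤? 5) →-dec (F s + newBound s t ≤? F (s + t))) 6) 6)

-- If U is the part of degree ≥ 2 of an order ideal of monomials containing all variables, then
-- the monomials of degree ≥ 2 bordered by U are those in U together with the minimal monomials outside.
Bordered : List (Vec ℕ k) → Vec ℕ k → Set
Bordered U c = 2 ≤ deg c × ∀ i d → c ≡ unit i ⊕ d → 2 ≤ deg d → d ∈ U

-- The least common multiple of two monomials.
join : Vec ℕ k → Vec ℕ k → Vec ℕ k
join = zipWith _⊔_

join-absorb : ∀ i (a : Vec ℕ k) → join a (unit i ⊕ a) ≡ unit i ⊕ a
join-absorb zero    (x ∷ a) = cong₂ _∷_ (m≤n⇒m⊔n≡n (n≤1+n x)) (idem a)
  where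
  idem : ∀ {k} (a : Vec ℕ k) → join a (𝟎 ⊕ a) ≡ 𝟎 ⊕ a
  idem []      = refl
  idem (y ∷ a) = cong₂ _∷_ (⊔-idem y) (idem a)
join-absorb (suc i) (x ∷ a) = cong₂ _∷_ (⊔-idem x) (join-absorb i a)

join-comm : ∀ (a b : Vec ℕ k) → join a b ≡ join b a
join-comm = Vec.zipWith-comm ⊔-comm

join-units : ∀ {i j} → i ≢ j → ∀ (w : Vec ℕ k) → join (unit i ⊕ w) (unit j ⊕ w) ≡ unit i ⊕ (unit j ⊕ w)
join-units {i = zero}  {zero}  i≢j w       = contradiction refl i≢j
join-units {i = zero}  {suc j} i≢j (x ∷ w) = cong₂ _∷_ (m≥n⇒m⊔n≡m (n≤1+n x))
  (≡.trans (cong (λ v → join v (unit j ⊕ w)) (⊕-identityˡ w))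
  (≡.trans (join-absorb j w) (≡.sym (⊕-identityˡ (unit j ⊕ w)))))
join-units {i = suc i} {zero}  i≢j (x ∷ w) = cong₂ _∷_ (m≤n⇒m⊔n≡n (n≤1+n x))
  (≡.trans (cong (join (unit i ⊕ w)) (⊕-identityˡ w))
  (≡.trans (≡.trans (join-comm (unit i ⊕ w) w) (join-absorb i w)) (cong (unit i ⊕_) (≡.sym (⊕-identityˡ w)))))
join-units {i = suc i} {suc j} i≢j (x ∷ w) = cong₂ _∷_ (⊔-idem x) (join-units (i≢j ∘ cong suc) w)

-- Multiplication by the last variable that occurs. It recovers a monomial from its quotient by its
-- last variable if that variable still divides the quotient.
bumpLast : Vec ℕ k → Vec ℕ k
bumpLast []       = []
bumpLast (x ∷ xs) with xs ≟ᵛ 𝟎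
... | yes _ = suc x ∷ xs
... | no  _ = x ∷ bumpLast xs

bumpLast-𝟎 : ∀ x → bumpLast (x ∷ 𝟎 {k}) ≡ suc x ∷ 𝟎
bumpLast-𝟎 {k} x with 𝟎 {k} ≟ᵛ 𝟎
... | yes _  = refl
... | no 𝟎≢𝟎 = contradiction refl 𝟎≢𝟎

bumpLast-≢𝟎 : ∀ x {a : Vec ℕ k} → a ≢ 𝟎 → bumpLast (x ∷ a) ≡ x ∷ bumpLast a
bumpLast-≢𝟎 x {a} a≢𝟎 with a ≟ᵛ 𝟎
... | yes a≡𝟎 = contradiction a≡𝟎 a≢𝟎
... | no _    = refl

unit⊕≢𝟎 : ∀ i (a : Vec ℕ k) → unit i ⊕ a ≢ 𝟎
unit⊕≢𝟎 {k} i a eq with () ← ≡.trans (≡.sym (deg-unit⊕ i a)) (≡.trans (cong deg eq) (deg-𝟎 k))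

-- Here `j` is the last variable of `a`: if it still divides `b`, it is the last variable of `b` as
-- well, so `bumpLast` restores `a`.
divide-last : ∀ (a : Vec ℕ k) → a ≢ 𝟎 →
              ∃₂ λ j b → a ≡ unit j ⊕ b × (b ≢ 𝟎 × a ≡ bumpLast b ⊎ lookup b j ≡ 0)
divide-last []      a≢𝟎 = contradiction refl a≢𝟎
divide-last (x ∷ a) xa≢𝟎 with a ≟ᵛ 𝟎
divide-last (zero        ∷ a) xa≢𝟎 | yes refl = contradiction refl xa≢𝟎
divide-last (suc zero    ∷ a) xa≢𝟎 | yes refl = zero , 𝟎 , ≡.sym (⊕-identityʳ (unit zero)) , inj₂ refl
divide-last (suc (suc x) ∷ a) xa≢𝟎 | yes refl =
  zero , (suc x ∷ 𝟎) , cong (suc (suc x) ∷_) (≡.sym (⊕-identityˡ 𝟎)) , inj₁ ((λ ()) , ≡.sym (bumpLast-𝟎 (suc x)))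
divide-last (x ∷ a) xa≢𝟎 | no a≢𝟎 with divide-last a a≢𝟎
... | j , b , a≡ , inj₂ b_j≡0        = suc j , (x ∷ b) , cong (x ∷_) a≡ , inj₂ b_j≡0
... | j , b , a≡ , inj₁ (b≢𝟎 , bump) = suc j , (x ∷ b) , cong (x ∷_) a≡ ,
      inj₁ ((b≢𝟎 ∘ Vec.∷-injectiveʳ) , ≡.trans (cong (x ∷_) bump) (≡.sym (bumpLast-≢𝟎 x b≢𝟎)))

HeadPositive : Vec ℕ (suc k) → Set
HeadPositive (x ∷ _) = 1 ≤ x

headPositive? : ∀ (a : Vec ℕ (suc k)) → Dec (HeadPositive a)
headPositive? (x ∷ _) = 1 ≤? x

-- With c′ = suc x ∷ c and y its last variable, take u = c′ / y; if y does not divide u, then c′ is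
-- the least common multiple of u and any other maximal divisor.
determined : ∀ (U : List (Vec ℕ (suc k))) x c → 2 ≤ x + deg c → Bordered U (suc x ∷ c) →
             (∃ λ u → u ∈ U × HeadPositive u × suc x ∷ c ≡ bumpLast u) ⊎
             (∃₂ λ u v → (u ∈ U × HeadPositive u) × (v ∈ U × HeadPositive v) × u ≢ v × suc x ∷ c ≡ join u v)
determined {k} U x c 2≤ (_ , inU) with c ≟ᵛ 𝟎
... | yes refl = inj₁ ((x ∷ 𝟎) , inU zero (x ∷ 𝟎) (cong (suc x ∷_) (≡.sym (⊕-identityˡ 𝟎))) 2≤
                 , ≤-trans (s≤s z≤n) (≤-trans 2≤ (≤-reflexive (≡.trans (cong (x +_) (deg-𝟎 k)) (+-identityʳ x))))
                 , ≡.sym (bumpLast-𝟎 x))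
... | no c≢𝟎 with divide-last c c≢𝟎
...   | j , b , refl , inj₁ (b≢𝟎 , bump) = inj₁ ((suc x ∷ b)
        , inU (suc j) (suc x ∷ b) refl
            (≤-trans 2≤ (≤-reflexive (≡.trans (cong (x +_) (deg-unit⊕ j b)) (+-suc x (deg b)))))
        , s≤s z≤n
        , ≡.trans (cong (suc x ∷_) bump) (≡.sym (bumpLast-≢𝟎 (suc x) b≢𝟎)))
determined U (suc x) c 2≤ (_ , inU) | no _ | j , b , refl , inj₂ _ = inj₂
  ( (suc x ∷ (unit j ⊕ b)) , (suc (suc x) ∷ b)
  , (inU zero (suc x ∷ (unit j ⊕ b)) (cong (suc (suc x) ∷_) (≡.sym (⊕-identityˡ _))) 2≤ , s≤s z≤n)
  , (inU (suc j) (suc (suc x) ∷ b) refl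
      (≤-trans 2≤ (≤-reflexive (≡.trans (cong (suc x +_) (deg-unit⊕ j b)) (+-suc (suc x) (deg b))))) , s≤s z≤n)
  , (λ eq → 1+n≢n (≡.sym (Vec.∷-injectiveˡ eq)))
  , cong₂ _∷_ (≡.sym (m≤n⇒m⊔n≡n (n≤1+n (suc x)))) (≡.trans (≡.sym (join-absorb j b)) (join-comm b _)))
-- The quotient by the first variable is now free of it, so a variable `i` of `b` is divided out
-- instead; it exists by degree and differs from `j` because `j` no longer divides `b`.
determined U zero c 2≤ (_ , inU) | no _ | j , b , refl , inj₂ b_j≡0
  with i , w , refl ← deg≥1 b (s≤s⁻¹ (≤-trans 2≤ (≤-reflexive (deg-unit⊕ j b)))) = inj₂
  ( (1 ∷ (unit j ⊕ w)) , (1 ∷ (unit i ⊕ w))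
  , (inU (suc i) (1 ∷ (unit j ⊕ w)) (cong (1 ∷_) (⊕-swap (unit j) (unit i) w))
      (s≤s (≤-trans (s≤s z≤n) (≤-reflexive (≡.sym (deg-unit⊕ j w))))) , s≤s z≤n)
  , (inU (suc j) (1 ∷ (unit i ⊕ w)) refl
      (s≤s (≤-trans (s≤s z≤n) (≤-reflexive (≡.sym (deg-unit⊕ i w))))) , s≤s z≤n)
  , (λ eq → j≢i (unit-injective
      (⊕-cancelˡ w _ _ (≡.trans (⊕-comm w _) (≡.trans (Vec.∷-injectiveʳ eq) (⊕-comm _ w))))))
  , cong (1 ∷_) (≡.sym (join-units j≢i w)))
  where
  j≢i : j ≢ i
  j≢i refl with () ← ≡.trans (≡.sym b_j≡0) (≡.trans (lookup-⊕ i (unit i) w) (cong (_+ lookup w i) (lookup-at i 1)))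

zeroTails : List (Vec ℕ (suc k)) → List (Vec ℕ k)
zeroTails []               = []
zeroTails ((zero  ∷ a) ∷ U) = a ∷ zeroTails U
zeroTails ((suc _ ∷ _) ∷ U) = zeroTails U

∈-zeroTails : ∀ {U : List (Vec ℕ (suc k))} {a} → (0 ∷ a) ∈ U → a ∈ zeroTails U
∈-zeroTails {U = (zero  ∷ _) ∷ U} (here refl) = here refl
∈-zeroTails {U = (zero  ∷ _) ∷ U} (there a∈)  = there (∈-zeroTails a∈)
∈-zeroTails {U = (suc _ ∷ _) ∷ U} (there a∈)  = ∈-zeroTails a∈

length-zeroTails : ∀ (U : List (Vec ℕ (suc k))) → length (zeroTails U) + length (filter headPositive? U) ≡ length U
length-zeroTails []                = refl
length-zeroTails ((zero  ∷ a) ∷ U) = cong suc (length-zeroTails U)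
length-zeroTails ((suc _ ∷ _) ∷ U) = ≡.trans (+-suc _ _) (cong suc (length-zeroTails U))

new-covers : ∀ (U : List (Vec ℕ (suc k))) →
             ∃ λ N → length N ≤ newBound (length (zeroTails U)) (length (filter headPositive? U)) ×
                     (∀ x c → 2 ≤ x + deg c → Bordered U (suc x ∷ c) → suc x ∷ c ∈ N)
new-covers {k} U = go (length (zeroTails U)) refl (filter headPositive? U) refl
  where
  multiples : List (Vec ℕ (suc k))
  multiples = map (unit zero ⊕_) U
  length-multiples : length multiples ≡ length (zeroTails U) + length (filter headPositive? U)
  length-multiples = ≡.trans (List.length-map _ U) (≡.sym (length-zeroTails U))
  multiples-cover : ∀ x c → 2 ≤ x + deg c → Bordered U (suc x ∷ c) → suc x ∷ c ∈ multiples
  multiples-cover x c 2≤ (_ , inU) = subst (_∈ multiples) (cong (suc x ∷_) (⊕-identityˡ c))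
    (∈-map⁺ (unit zero ⊕_) (inU zero (x ∷ c) (cong (suc x ∷_) (≡.sym (⊕-identityˡ c))) 2≤))
  positive∈ : ∀ {u V} → filter headPositive? U ≡ V → u ∈ U × HeadPositive u → u ∈ V
  positive∈ refl (u∈ , pos) = ∈-filter⁺ headPositive? u∈ pos
  -- Naming both data lets a case split evaluate `newBound`. For `s = 0`, or with at least three
  -- positive members, all products of `U` with the first variable are taken; otherwise `determined`
  -- yields an explicit list.
  go : ∀ s → length (zeroTails U) ≡ s → ∀ V → filter headPositive? U ≡ V →
       ∃ λ N → length N ≤ newBound s (length V) ×
               (∀ x c → 2 ≤ x + deg c → Bordered U (suc x ∷ c) → suc x ∷ c ∈ N)
  go zero eqₛ V eq = multiples
    , ≤-reflexive (≡.trans length-multiples (cong₂ (λ s V → s + length V) eqₛ eq)) , multiples-cover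
  go (suc _) _ [] eq = [] , z≤n , covers
    where
    covers : ∀ x c → 2 ≤ x + deg c → Bordered U (suc x ∷ c) → suc x ∷ c ∈ []
    covers x c 2≤ bd with determined U x c 2≤ bd
    ... | inj₁ (u , u∈ , pos , _)    with () ← positive∈ eq (u∈ , pos)
    ... | inj₂ (u , v , u∈ , _)      with () ← positive∈ eq u∈
  go (suc _) _ (p ∷ []) eq = bumpLast p ∷ [] , ≤-refl , covers
    where
    covers : ∀ x c → 2 ≤ x + deg c → Bordered U (suc x ∷ c) → suc x ∷ c ∈ bumpLast p ∷ []
    covers x c 2≤ bd with determined U x c 2≤ bd
    ... | inj₁ (u , u∈ , pos , c≡) with here refl ← positive∈ eq (u∈ , pos) = here c≡
    ... | inj₂ (u , v , u∈ , v∈ , u≢v , _) with here refl ← positive∈ eq u∈ | here refl ← positive∈ eq v∈ = contradiction refl u≢v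
  go (suc _) _ (p ∷ q ∷ []) eq = bumpLast p ∷ bumpLast q ∷ join p q ∷ [] , ≤-refl , covers
    where
    covers : ∀ x c → 2 ≤ x + deg c → Bordered U (suc x ∷ c) → suc x ∷ c ∈ bumpLast p ∷ bumpLast q ∷ join p q ∷ []
    covers x c 2≤ bd with determined U x c 2≤ bd
    covers x c 2≤ bd | inj₁ (u , u∈ , pos , c≡) with positive∈ eq (u∈ , pos)
    ... | here refl         = here c≡
    ... | there (here refl) = there (here c≡)
    covers x c 2≤ bd | inj₂ (u , v , u∈ , v∈ , u≢v , c≡) with positive∈ eq u∈ | positive∈ eq v∈
    ... | here refl         | here refl         = contradiction refl u≢v
    ... | here refl         | there (here refl) = there (there (here c≡))
    ... | there (here refl) | here refl         = there (there (here (≡.trans c≡ (join-comm q p))))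
    ... | there (here refl) | there (here refl) = contradiction refl u≢v
  go (suc _) eqₛ (_ ∷ _ ∷ _ ∷ _) eq = multiples
    , ≤-reflexive (≡.trans length-multiples (cong₂ (λ s V → s + length V) eqₛ eq)) , multiples-cover

-- The binomial coefficient counts the quadratic monomials, all of which are bordered; `F` accounts
-- for the higher degrees. A bordered monomial avoids the first variable, where induction applies,
-- or is quadratic and divisible by it, or falls under `new-covers`.
bordered-cover : ∀ k (U : List (Vec ℕ k)) → length U ≤ 5 →
                 ∃ λ L → length L ≤ suc k C 2 + F (length U) × (∀ c → Bordered U c → c ∈ L)
bordered-cover zero    U _ = [] , z≤n , λ where [] (() , _)
bordered-cover (suc k) U U≤5
  with L₀ , L₀≤ , covers₀ ← bordered-cover k (zeroTails U)
         (≤-trans (m≤m+n _ _) (≤-trans (≤-reflexive (length-zeroTails U)) U≤5))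
  with N , N≤ , covers ← new-covers U = L , L≤ , L-covers
  where
  quadrics L : List (Vec ℕ (suc k))
  quadrics = map (λ i → unit zero ⊕ unit i) (allFin (suc k))
  L = map (0 ∷_) L₀ ++ quadrics ++ N
  s t : ℕ
  s = length (zeroTails U)
  t = length (filter headPositive? U)
  open ≤-Reasoning
  arith : ∀ a f q n → a + f + (q + n) ≡ q + a + (f + n)
  arith = solve-∀
  L≤ : length L ≤ suc (suc k) C 2 + F (length U)
  L≤ = begin
    length L
      ≡⟨ List.length-++ (map (0 ∷_) L₀) ⟩
    length (map (0 ∷_) L₀) + length (quadrics ++ N)
      ≡⟨ cong₂ _+_ (List.length-map _ L₀) (List.length-++ quadrics) ⟩
    length L₀ + (length quadrics + length N)
      ≡⟨ cong (λ n → length L₀ + (n + length N)) (length-map-allFin (suc k)) ⟩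
    length L₀ + (suc k + length N)
      ≤⟨ +-mono-≤ L₀≤ (+-monoʳ-≤ (suc k) N≤) ⟩
    suc k C 2 + F s + (suc k + newBound s t)
      ≡⟨ arith (suc k C 2) (F s) (suc k) (newBound s t) ⟩
    suc k + suc k C 2 + (F s + newBound s t)
      ≤⟨ +-monoʳ-≤ (suc k + suc k C 2) (F-newBound s t (≤-trans (≤-reflexive (length-zeroTails U)) U≤5)) ⟩
    suc k + suc k C 2 + F (s + t)
      ≡⟨ cong₂ _+_ (≡.trans (cong (_+ suc k C 2) (≡.sym (nC1≡n (suc k)))) (nCk+nC[k+1]≡[n+1]C[k+1] (suc k) 1))
                   (cong F (length-zeroTails U)) ⟩
    suc (suc k) C 2 + F (length U) ∎
  L-covers : ∀ c → Bordered U c → c ∈ L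
  L-covers (zero ∷ c) (2≤ , inU) =
    ∈-++⁺ˡ (∈-map⁺ (0 ∷_) (covers₀ c (2≤ , λ i d c≡ 2≤d → ∈-zeroTails (inU (suc i) (0 ∷ d) (cong (0 ∷_) c≡) 2≤d))))
  L-covers (suc x ∷ c) bd@(2≤ , _) with 2 ≤? x + deg c
  ... | yes 2≤′ = ∈-++⁺ʳ (map (0 ∷_) L₀) (∈-++⁺ʳ quadrics (covers x c 2≤′ bd))
  ... | no 2≰ with i , xc≡ ← deg≡1 (x ∷ c) (≤-antisym (s≤s⁻¹ (≰⇒> 2≰)) (s≤s⁻¹ 2≤)) =
    ∈-++⁺ʳ (map (0 ∷_) L₀) (∈-++⁺ˡ (subst (_∈ quadrics)
      (≡.trans (cong (unit zero ⊕_) (≡.sym xc≡)) (cong (suc x ∷_) (⊕-identityˡ c)))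
      (∈-map⁺ (λ i → unit zero ⊕ unit i) (∈-allFin i))))

-- The presentation by minimal non-standard monomials

_∈?_ : ∀ (a : Vec ℕ k) as → Dec (a ∈ as)
_∈?_ = DecMembership._∈?_ _≟ᵛ_

-- Injectivity is asked on the list alone, because `residue` below is shown to be injective only on
-- the standard monomials.
Unique-map : ∀ {A B : Set} (f : A → B) {xs} → Unique xs →
             (∀ {x y} → x ∈ xs → y ∈ xs → f x ≡ f y → x ≡ y) → Unique (map f xs)
Unique-map f []       inj = []
Unique-map f (x≢ ∷ u) inj =
  All.map⁺ (All.tabulate λ y∈ eq → All.lookup x≢ y∈ (inj (here refl) (there y∈) eq)) ∷
  Unique-map f u (λ x∈ y∈ → inj (there x∈) (there y∈))

box : ∀ k → ℕ → List (Vec ℕ k)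
box zero    n = [] ∷ []
box (suc k) n = cartesianProductWith _∷_ (upTo n) (box k n)

Unique-box : ∀ k n → Unique (box k n)
Unique-box zero    n = [] ∷ []
Unique-box (suc k) n = Unique.cartesianProductWith⁺ _∷_ Vec.∷-injective (Unique.upTo⁺ n) (Unique-box k n)

∈-box : ∀ {n} (a : Vec ℕ k) → (∀ i → lookup a i < n) → a ∈ box k n
∈-box []      a<n = here refl
∈-box (x ∷ a) a<n = ∈-cartesianProductWith⁺ _∷_ (∈-upTo⁺ (a<n zero)) (∈-box a (a<n ∘ suc))

multiplicity≤ : ∀ {m} {g′ : Vec ℕ k} → IsMinGenNumMonoid (m ∷ g′) → ∀ i → m ≤ lookup (m ∷ g′) i
multiplicity≤ _            zero    = ≤-refl
multiplicity≤ (incr , _) i@(suc _) = <⇒≤ (incr zero i (s≤s z≤n))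

-- Minimality makes the `i`-th exponent positive; once that generator is removed, the rest has value
-- 0 and hence degree 0.
generator-unique : ∀ {g : Vec ℕ k} → IsMinGenNumMonoid g → (∀ i → 1 ≤ lookup g i) →
                   ∀ i a → φ g a ≡ lookup g i → a ≡ unit i
generator-unique {g = g} (_ , minimal , _) pos i a eq with lookup a i in a_i
... | zero = contradiction (a , a_i , eq) (minimal i)
... | suc x with b , refl ← at-split i 1 a (≤-trans (s≤s z≤n) (≤-reflexive (≡.sym a_i))) =
  ≡.trans (cong (unit i ⊕_) (deg≡0 b (n≤0⇒n≡0 deg≤0))) (⊕-identityʳ (unit i))
  where
  open ≤-Reasoning
  deg≤0 : deg b ≤ 0
  deg≤0 = begin
    deg b     ≡⟨ *-identityʳ (deg b) ⟨
    deg b * 1 ≤⟨ deg*≤φ g 1 pos b ⟩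
    φ g b     ≡⟨ +-cancelˡ-≡ (lookup g i) _ _ (≡.trans (≡.sym (φ-unit⊕ g i b)) (≡.trans eq (≡.sym (+-identityʳ (lookup g i))))) ⟩
    0         ∎

infix 4 _≺_ _≺?_

_≺_ : Vec ℕ k → Vec ℕ k → Set
_≺_ = Lex-< _≡_ _<_

_≺?_ : ∀ (a b : Vec ℕ k) → Dec (a ≺ b)
_≺?_ = Lex.<-decidable _≟_ _<?_

≺-irrefl : ∀ {a : Vec ℕ k} → ¬ a ≺ a
≺-irrefl = Lex.<-irrefl <-irrefl (≡⇒Pointwise-≡ refl)

≺-wellFounded : WellFounded (_≺_ {k})
≺-wellFounded = Lex.<-wellFounded ≡.trans (λ where refl lt → lt) <-wellFounded

≺-⊕ : ∀ {a b : Vec ℕ k} c → a ≺ b → a ⊕ c ≺ b ⊕ c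
≺-⊕ []      (Lex.base ())
≺-⊕ (z ∷ c) (this x<y _)    = this (+-monoˡ-< z x<y) refl
≺-⊕ (z ∷ c) (next refl a≺b) = next refl (≺-⊕ c a≺b)

Gen-sound : ∀ {g : Vec ℕ k} {R} → All (λ p → φ g (proj₁ p) ≡ φ g (proj₂ p)) R →
            ∀ {a b} → Gen R a b → φ g a ≡ φ g b
Gen-sound sound (base ab∈)  = All.lookup sound ab∈
Gen-sound sound refl        = refl
Gen-sound sound (sym p)     = ≡.sym (Gen-sound sound p)
Gen-sound sound (trans p q) = ≡.trans (Gen-sound sound p) (Gen-sound sound q)
Gen-sound {g = g} sound (add {a} {b} p c) =
  ≡.trans (φ-⊕ g a c) (≡.trans (cong (_+ φ g c) (Gen-sound sound p)) (≡.sym (φ-⊕ g b c)))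

module UpperBound {e} (m : ℕ) (g′ : Vec ℕ e) ⦃ _ : NonZero m ⦄ (minGen : IsMinGenNumMonoid (m ∷ g′)) where

  g : Vec ℕ (suc e)
  g = m ∷ g′

  g≥1 : ∀ i → 1 ≤ lookup g i
  g≥1 i = ≤-trans (>-nonZero⁻¹ m) (multiplicity≤ minGen i)

  -- Among factorizations of the same element, a smaller key means a larger exponent of
  -- the multiplicity, ties being broken lexicographically.
  key : Vec ℕ (suc e) → Vec ℕ (suc e)
  key (_ ∷ b) = φ g′ b ∷ b

  key-⊕ : ∀ a b → key (a ⊕ b) ≡ key a ⊕ key b
  key-⊕ (_ ∷ a) (_ ∷ b) = cong (_∷ a ⊕ b) (φ-⊕ g′ a b)

  key-step : ∀ {a b} c → key a ≺ key b → key (a ⊕ c) ≺ key (b ⊕ c)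
  key-step {a} {b} c a≺b = ≡.subst₂ _≺_ (≡.sym (key-⊕ a c)) (≡.sym (key-⊕ b c)) (≺-⊕ (key c) a≺b)

  -- The other `b`, called standard in the names below, are the optimal factorizations without the
  -- multiplicity, as the standard monomials of a Gröbner basis.
  Reducible : Vec ℕ e → Set
  Reducible b = ∃ λ a → φ g a ≡ φ g (0 ∷ b) × key a ≺ key (0 ∷ b)

  reducible? : Decidable Reducible
  reducible? b = factorization? g g≥1 (λ a → key a ≺? key (0 ∷ b)) (φ g (0 ∷ b))

  -- Adding `c` to both factorizations preserves the order of their keys. Hence the standard
  -- monomials form an order ideal.
  Reducible-⊕ : ∀ b c → Reducible b → Reducible (b ⊕ c)
  Reducible-⊕ b c (a , eq , a≺b) = a ⊕ (0 ∷ c)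
    , ≡.trans (φ-⊕ g a (0 ∷ c)) (≡.trans (cong (_+ φ g′ c) eq) (≡.sym (φ-⊕ g (0 ∷ b) (0 ∷ c))))
    , key-step {a} {0 ∷ b} (0 ∷ c) a≺b

  -- The smaller key belongs to at least as many copies of `m`, so `p` copies cancel on both sides;
  -- keys ignore the exponent of `m`.
  smaller-key⇒Reducible : ∀ p b q b′ → φ g (p ∷ b) ≡ φ g (q ∷ b′) → key (q ∷ b′) ≺ key (p ∷ b) → Reducible b
  smaller-key⇒Reducible p b q b′ eq lt = (q ∸ p ∷ b′) , eq′ , lt
    where
    φ-mono : ∀ {x y} {u v : Vec ℕ e} → (x ∷ u) ≺ (y ∷ v) → x ≤ y
    φ-mono (this x<y _)  = <⇒≤ x<y
    φ-mono (next refl _) = ≤-refl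
    open ≤-Reasoning
    p≤q : p ≤ q
    p≤q = *-cancelʳ-≤ p q m (+-cancelʳ-≤ (φ g′ b) (p * m) (q * m) (begin
      p * m + φ g′ b  ≡⟨ eq ⟩
      q * m + φ g′ b′ ≤⟨ +-monoʳ-≤ (q * m) (φ-mono lt) ⟩
      q * m + φ g′ b  ∎))
    eq′ : (q ∸ p) * m + φ g′ b′ ≡ φ g′ b
    eq′ = +-cancelˡ-≡ (p * m) _ _ (begin-equality
      p * m + ((q ∸ p) * m + φ g′ b′) ≡⟨ +-assoc (p * m) _ _ ⟨
      p * m + (q ∸ p) * m + φ g′ b′   ≡⟨ cong (_+ φ g′ b′) (*-distribʳ-+ m p (q ∸ p)) ⟨
      (p + (q ∸ p)) * m + φ g′ b′     ≡⟨ cong (λ x → x * m + φ g′ b′) (m+[n∸m]≡n p≤q) ⟩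
      q * m + φ g′ b′                 ≡⟨ eq ⟨
      p * m + φ g′ b                  ∎)

  -- The free exponents `p` and `q` make this a statement about congruence modulo `m`. If the keys
  -- differed, the vector with the larger one would be reducible.
  standard-unique : ∀ p b q b′ → ¬ Reducible b → ¬ Reducible b′ → φ g (p ∷ b) ≡ φ g (q ∷ b′) → b ≡ b′
  standard-unique p b q b′ std std′ eq with Lex.<-cmp ≡.sym <-cmp (key (p ∷ b)) (key (q ∷ b′))
  ... | tri< lt _ _   = contradiction (smaller-key⇒Reducible q b′ p b (≡.sym eq) lt) std′
  ... | tri≈ _ same _ = Vec.∷-injectiveʳ (Pointwise-≡⇒≡ same)
  ... | tri> _ _ gt   = contradiction (smaller-key⇒Reducible p b q b′ eq gt) std

  𝟎-standard : ¬ Reducible 𝟎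
  𝟎-standard (a , eq , lt) = ≺-irrefl (subst (λ v → key v ≺ key 𝟎) (deg≡0 a (n≤0⇒n≡0 deg≤0)) lt)
    where
    open ≤-Reasoning
    deg≤0 : deg a ≤ 0
    deg≤0 = begin
      deg a       ≡⟨ *-identityʳ (deg a) ⟨
      deg a * 1   ≤⟨ deg*≤φ g 1 g≥1 a ⟩
      φ g a       ≡⟨ ≡.trans eq (φ-𝟎 g) ⟩
      0           ∎

  unit-standard : ∀ i → ¬ Reducible (unit i)
  unit-standard i (a , eq , lt) =
    ≺-irrefl (subst (λ v → key v ≺ key (0 ∷ unit i))
                    (generator-unique minGen g≥1 (suc i) a (≡.trans eq (φ-unit g (suc i)))) lt)

  Reducible⇒deg≥2 : ∀ c → Reducible c → 2 ≤ deg c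
  Reducible⇒deg≥2 c red with deg c in deg-c
  ... | 0 = contradiction (subst Reducible (deg≡0 c deg-c) red) 𝟎-standard
  ... | 1 with i , refl ← deg≡1 c deg-c = contradiction red (unit-standard i)
  ... | suc (suc _) = s≤s (s≤s z≤n)

  -- The product of `m` and the `i`-th generator is also a multiple of `m` alone, with smaller key,
  -- so exponents from `m` on are reducible. This confines the standard monomials to a finite box.
  standard-bound : ∀ b → ¬ Reducible b → ∀ i → lookup b i < m
  standard-bound b std i with lookup b i <? m
  ... | yes b_i<m = b_i<m
  ... | no b_i≮m with c , refl ← at-split i m b (≮⇒≥ b_i≮m) =
    contradiction (Reducible-⊕ (at i m) c ((lookup g′ i ∷ 𝟎) , eq , this lt refl)) std
    where
    eq : lookup g′ i * m + φ g′ 𝟎 ≡ φ g′ (at i m)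
    eq = ≡.trans (cong (lookup g′ i * m +_) (φ-𝟎 g′))
        (≡.trans (+-identityʳ _) (≡.trans (*-comm (lookup g′ i) m) (≡.sym (φ-at g′ i m))))
    lt : φ g′ 𝟎 < φ g′ (at i m)
    lt = ≡.subst₂ _<_ (≡.sym (φ-𝟎 g′)) (≡.sym (φ-at g′ i m)) (*-mono-≤ (>-nonZero⁻¹ m) (g≥1 (suc i)))

  standards : List (Vec ℕ e)
  standards = filter (¬? ∘ reducible?) (box e m)

  ∈-standards : ∀ {b} → ¬ Reducible b → b ∈ standards
  ∈-standards {b} std = ∈-filter⁺ (¬? ∘ reducible?) (∈-box b (standard-bound b std)) std

  Unique-standards : Unique standards
  Unique-standards = Unique.filter⁺ (¬? ∘ reducible?) (Unique-box e m)

  length-standards : length standards ≤ m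
  length-standards = begin
    length standards                        ≡⟨ List.length-map _ standards ⟨
    length (map residue standards)          ≤⟨ length-⊆ (Unique-map residue Unique-standards residue-injective) ⊆upTo ⟩
    length (upTo m)                         ≡⟨ List.length-upTo m ⟩
    m                                       ∎
    where
    open ≤-Reasoning
    residue : Vec ℕ e → ℕ
    residue b = φ g′ b % m
    ⊆upTo : ∀ {x} → x ∈ map residue standards → x ∈ upTo m
    ⊆upTo x∈ with b , _ , refl ← ∈-map⁻ residue x∈ = ∈-upTo⁺ (m%n<n (φ g′ b) m)
    residue-injective : ∀ {b b′} → b ∈ standards → b′ ∈ standards → residue b ≡ residue b′ → b ≡ b′
    residue-injective {b} {b′} b∈ b′∈ same =
      -- Each side receives the quotient of the other, so equal residues make the two totals equal.
      standard-unique (φ g′ b′ / m) b (φ g′ b / m) b′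
        (proj₂ (∈-filter⁻ (¬? ∘ reducible?) {xs = box e m} b∈)) (proj₂ (∈-filter⁻ (¬? ∘ reducible?) {xs = box e m} b′∈)) (begin-equality
        φ g′ b′ / m * m + φ g′ b
          ≡⟨ cong (φ g′ b′ / m * m +_) (m≡m%n+[m/n]*n (φ g′ b) m) ⟩
        φ g′ b′ / m * m + (residue b + φ g′ b / m * m)
          ≡⟨ arith (φ g′ b′ / m * m) (residue b) _ ⟩
        φ g′ b / m * m + (residue b + φ g′ b′ / m * m)
          ≡⟨ cong (λ r → φ g′ b / m * m + (r + φ g′ b′ / m * m)) same ⟩
        φ g′ b / m * m + (residue b′ + φ g′ b′ / m * m)
          ≡⟨ cong (φ g′ b / m * m +_) (m≡m%n+[m/n]*n (φ g′ b′) m) ⟨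
        φ g′ b / m * m + φ g′ b′ ∎)
      where
      arith : ∀ x y z → x + (y + z) ≡ z + (y + x)
      arith = solve-∀

  deg≥2? : Decidable (λ (b : Vec ℕ e) → 2 ≤ deg b)
  deg≥2? b = 2 ≤? deg b

  nonlinear : List (Vec ℕ e)
  nonlinear = filter deg≥2? standards

  ∈-nonlinear : ∀ {b} → ¬ Reducible b → 2 ≤ deg b → b ∈ nonlinear
  ∈-nonlinear std 2≤ = ∈-filter⁺ deg≥2? (∈-standards std) 2≤

  nonlinear⇒standard : ∀ {b} → b ∈ nonlinear → 2 ≤ deg b × ¬ Reducible b
  nonlinear⇒standard b∈ with b∈′ , 2≤ ← ∈-filter⁻ deg≥2? {xs = standards} b∈ =
    2≤ , proj₂ (∈-filter⁻ (¬? ∘ reducible?) {xs = box e m} b∈′)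

  -- The trivial monomial and the `e` variables are standard, so they use up `e + 1` of the at most
  -- `m` standard monomials.
  length-nonlinear : length nonlinear + suc e ≤ m
  length-nonlinear = begin
    length nonlinear + suc e          ≡⟨ cong (length nonlinear +_) (cong suc (length-map-allFin e)) ⟨
    length nonlinear + length linear  ≤⟨ +-monoʳ-≤ (length nonlinear) (length-⊆ Unique-linear linear⊆) ⟩
    length nonlinear + length (filter (¬? ∘ deg≥2?) standards) ≡⟨ length-filter+ deg≥2? standards ⟩
    length standards                  ≤⟨ length-standards ⟩
    m                                 ∎
    where
    open ≤-Reasoning
    linear : List (Vec ℕ e)
    linear = 𝟎 ∷ map unit (allFin e)
    Unique-linear : Unique linear
    Unique-linear = All.map⁺ (All.tabulate λ {i} _ eq → 0≢1+n (≡.trans (≡.sym (deg-𝟎 e)) (≡.trans (cong deg eq) (deg-at i 1))))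
                    ∷ Unique.map⁺ unit-injective (Unique.allFin⁺ e)
    linear⊆ : ∀ {b} → b ∈ linear → b ∈ filter (¬? ∘ deg≥2?) standards
    linear⊆ (here refl) = ∈-filter⁺ (¬? ∘ deg≥2?) (∈-standards 𝟎-standard)
      (λ 2≤ → contradiction (≤-trans 2≤ (≤-reflexive (deg-𝟎 e))) λ ())
    linear⊆ (there b∈) with i , _ , refl ← ∈-map⁻ unit b∈ = ∈-filter⁺ (¬? ∘ deg≥2?) (∈-standards (unit-standard i))
      (λ 2≤ → contradiction (≤-trans 2≤ (≤-reflexive (deg-at i 1))) λ where (s≤s ()))

  -- Variables are divided out while the quotient stays reducible; `n` bounds the degree and ensures
  -- termination.
  minimal-reducible : ∀ n b → deg b ≤ n → Reducible b →
    ∃₂ λ c d → b ≡ c ⊕ d × Reducible c × (∀ i c′ → c ≡ unit i ⊕ c′ → ¬ Reducible c′)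
  minimal-reducible n b deg≤ red with Fin.any? reducibleAt?
    where
    ReducibleAt : Fin e → Set
    ReducibleAt i = 1 ≤ lookup b i × ∃ λ c → b ≡ unit i ⊕ c × Reducible c
    reducibleAt? : Decidable ReducibleAt
    reducibleAt? i with 1 ≤? lookup b i
    ... | no ≰ = no (≰ ∘ proj₁)
    ... | yes 1≤ with c , b≡ ← at-split i 1 b 1≤ with reducible? c
    ...   | yes red = yes (1≤ , c , b≡ , red)
    ...   | no ¬red = no λ (_ , c′ , b≡′ , red) →
              ¬red (subst Reducible (⊕-cancelˡ (unit i) c′ c (≡.trans (≡.sym b≡′) b≡)) red)
  ... | no none = b , 𝟎 , ≡.sym (⊕-identityʳ b) , red , λ i c b≡ redc → none (i
        , ≤-trans (≤-reflexive (≡.sym (lookup-at i 1)))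
            (≤-trans (m≤m+n _ (lookup c i)) (≤-reflexive (≡.trans (≡.sym (lookup-⊕ i (unit i) c)) (cong (λ v → lookup v i) (≡.sym b≡)))))
        , c , b≡ , redc)
  minimal-reducible zero    _ deg≤ red | yes (i , _ , c , refl , redc) with () ← ≤-trans (≤-reflexive (≡.sym (deg-unit⊕ i c))) deg≤
  minimal-reducible (suc n) _ deg≤ red | yes (i , _ , c , refl , redc)
    with c₀ , d , refl , rest ← minimal-reducible n c (s≤s⁻¹ (≤-trans (≤-reflexive (≡.sym (deg-unit⊕ i c))) deg≤)) redc =
    c₀ , unit i ⊕ d , ⊕-swap (unit i) c₀ d , rest

  -- The value at a standard `c` is a default giving a trivial relation, so `φ-reduct` holds for
  -- every member of the cover.
  reduct : Vec ℕ e → Vec ℕ (suc e)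
  reduct c with reducible? c
  ... | yes (a , _) = a
  ... | no _        = 0 ∷ c

  φ-reduct : ∀ c → φ g (0 ∷ c) ≡ φ g (reduct c)
  φ-reduct c with reducible? c
  ... | yes (a , eq , _) = ≡.sym eq
  ... | no _             = refl

  key-reduct : ∀ c → Reducible c → key (reduct c) ≺ key (0 ∷ c)
  key-reduct c red with reducible? c
  ... | yes (a , _ , lt) = lt
  ... | no ¬red          = contradiction red ¬red

  -- The cover contains the standard monomials of degree at least 2 and the minimal reducible ones.
  -- Once the former are removed, one relation per remaining member suffices to rewrite every vector
  -- to a standard one.
  small-presentation : length nonlinear ≤ 5 →
    ∃ λ R → IsPresentation g R × length nonlinear + length R ≤ suc e C 2 + F (length nonlinear)
  small-presentation ≤5 with L , L≤ , covers ← bordered-cover e nonlinear ≤5 =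
    R , (sound , complete) , bound
    where
    corners : List (Vec ℕ e)
    corners = filter (¬? ∘ (_∈? nonlinear)) L
    relation : Vec ℕ e → Vec ℕ (suc e) × Vec ℕ (suc e)
    relation c = (0 ∷ c) , reduct c
    R : List (Vec ℕ (suc e) × Vec ℕ (suc e))
    R = map relation corners

    sound : All (λ p → φ g (proj₁ p) ≡ φ g (proj₂ p)) R
    sound = All.map⁺ (All.tabulate λ {c} _ → φ-reduct c)

    corner∈ : ∀ {c} → Reducible c → (∀ i c′ → c ≡ unit i ⊕ c′ → ¬ Reducible c′) → c ∈ corners
    corner∈ {c} red minimal = ∈-filter⁺ (¬? ∘ (_∈? nonlinear))
      (covers c (Reducible⇒deg≥2 c red , λ i d c≡ 2≤ → ∈-nonlinear (minimal i d c≡) 2≤))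
      (λ c∈ → proj₂ (nonlinear⇒standard c∈) red)

    -- A translated relation replaces a minimal reducible divisor and strictly lowers the key, so
    -- rewriting ends.
    normalize : ∀ a → Acc _≺_ (key a) → ∃₂ λ p b → Gen R a (p ∷ b) × ¬ Reducible b
    normalize (p ∷ b) (acc rec) with reducible? b
    ... | no std = p , b , refl , std
    ... | yes red with c , d , refl , redc , minimal ← minimal-reducible (deg b) b ≤-refl red
                  with q , b′ , gen , std ← normalize (reduct c ⊕ (p ∷ d)) (rec (key-step {reduct c} {0 ∷ c} (p ∷ d) (key-reduct c redc))) =
      q , b′ , trans (add (base (∈-map⁺ relation (corner∈ redc minimal))) (p ∷ d)) gen , std

    complete : ∀ a b → φ g a ≡ φ g b → Gen R a b
    complete a b eq
      with p , a′ , gen , std ← normalize a (≺-wellFounded (key a))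
      with q , b′ , gen′ , std′ ← normalize b (≺-wellFounded (key b)) = trans gen (subst (λ v → Gen R v b) (≡.sym same) (sym gen′))
      where
      eq′ : φ g (p ∷ a′) ≡ φ g (q ∷ b′)
      eq′ = ≡.trans (≡.sym (Gen-sound sound gen)) (≡.trans eq (Gen-sound sound gen′))
      a′≡b′ : a′ ≡ b′
      a′≡b′ = standard-unique p a′ q b′ std std′ eq′
      same : p ∷ a′ ≡ q ∷ b′
      same = cong₂ _∷_ (*-cancelʳ-≡ p q m (+-cancelʳ-≡ (φ g′ a′) (p * m) (q * m)
                          (≡.trans eq′ (cong (λ v → q * m + φ g′ v) (≡.sym a′≡b′))))) a′≡b′

    bound : length nonlinear + length R ≤ suc e C 2 + F (length nonlinear)
    bound = ≤-trans (≤-reflexive (cong (length nonlinear +_) (List.length-map relation corners)))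
           (≤-trans (length-filter-∉ (_∈? nonlinear) (Unique.filter⁺ deg≥2? Unique-standards)
                      (λ {c} c∈ → covers c (proj₁ (nonlinear⇒standard c∈) , λ i d c≡ 2≤ →
                         ∈-nonlinear (λ red → proj₂ (nonlinear⇒standard c∈)
                           (subst Reducible (≡.trans (⊕-comm d (unit i)) (≡.sym c≡)) (Reducible-⊕ d (unit i) red))) 2≤) , c∈))
                    L≤)

-- The difference of `F s` and `s` never decreases, so the actual number `u` of standard monomials
-- of degree at least 2 may be replaced by its bound `s`.
F-growth : ∀ u s → u ≤ s → s ≤ 5 → F u + s ≤ F s + u
F-growth u s u≤s s≤5 = table (s≤s (≤-trans u≤s s≤5)) (s≤s s≤5) u≤s
  where
  table : ∀ {u} → u < 6 → ∀ {s} → s < 6 → u ≤ s → F u + s ≤ F s + u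
  table = from-yes (allUpTo? (λ u → allUpTo? (λ s → (u ≤? s) →-dec (F u + s ≤? F s + u)) 6) 6)

presentation≤ : ∀ {e} s (g : Vec ℕ (suc e)) → IsMinGenNumMonoid g → Vec.head g ≡ suc (e + s) → s ≤ 5 →
                ∃ λ R → IsPresentation g R × length R + s ≤ suc e C 2 + F s
presentation≤ {e} s (_ ∷ g′) minGen refl s≤5 = R , pres , final
  where
  open UpperBound (suc (e + s)) g′ minGen
  u : ℕ
  u = length nonlinear
  u≤s : u ≤ s
  u≤s = +-cancelʳ-≤ (suc e) u s (≤-trans length-nonlinear (≤-reflexive (+-comm (suc e) s)))
  small : ∃ λ R → IsPresentation g R × u + length R ≤ suc e C 2 + F u
  small = small-presentation (≤-trans u≤s s≤5)
  R = proj₁ small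
  pres = proj₁ (proj₂ small)
  arith₁ : ∀ u r s → u + (r + s) ≡ u + r + s
  arith₁ = solve-∀
  arith₂ : ∀ c f u → c + (f + u) ≡ u + (c + f)
  arith₂ = solve-∀
  open ≤-Reasoning
  final : length R + s ≤ suc e C 2 + F s
  final = +-cancelˡ-≤ u _ _ (begin
    u + (length R + s)     ≡⟨ arith₁ u (length R) s ⟩
    u + length R + s       ≤⟨ +-monoˡ-≤ s (proj₂ (proj₂ small)) ⟩
    suc e C 2 + F u + s    ≡⟨ +-assoc (suc e C 2) (F u) s ⟩
    suc e C 2 + (F u + s)  ≤⟨ +-monoʳ-≤ (suc e C 2) (F-growth u s u≤s s≤5) ⟩
    suc e C 2 + (F s + u)  ≡⟨ arith₂ (suc e C 2) (F s) u ⟩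
    u + (suc e C 2 + F s)  ∎)

-- Isolated factorizations

Isolated : Vec ℕ k → Vec ℕ k → Set
Isolated g a = ∀ i d → a ≡ unit i ⊕ d → ∀ d′ → φ g d′ ≡ φ g d → d′ ≡ d

Crosses : List (Vec ℕ k) → Vec ℕ k × Vec ℕ k → Set
Crosses A (p , q) = (p ∈ A × q ∉ A) ⊎ (p ∉ A × q ∈ A)

crosses? : ∀ (A : List (Vec ℕ k)) → Decidable (Crosses A)
crosses? A (p , q) = ((p ∈? A) ×-dec ¬? (q ∈? A)) ⊎-dec (¬? (p ∈? A) ×-dec (q ∈? A))

-- As in a forest: an edge leaving W is deleted together with its end in W.
length≤-by-cuts : ∀ n (R : List (Vec ℕ k × Vec ℕ k)) W → length R ≡ n → Unique W →
                  (∀ A {a} → a ∈ A → (∀ {x} → x ∈ A → x ∈ W) → ∃ λ e → e ∈ R × Crosses A e) →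
                  length W ≤ n
length≤-by-cuts n       R  []        _  _ _   = z≤n
length≤-by-cuts zero    [] W@(_ ∷ _) _  _ cut with _ , () , _ ← cut W (here refl) (λ x∈ → x∈)
length≤-by-cuts (suc n) R  W@(_ ∷ _) eq u cut with cut W (here refl) (λ x∈ → x∈)
... | e , e∈ , e-cuts = proceed e-cuts
  where
  remove : ∀ w → (∀ A → w ∉ A → (∀ {x} → x ∈ A → x ∈ W) → ¬ Crosses A e) → length W ≤ suc n
  remove w uncut = ≤-trans (length-⊆ u ⊆w∷W′) (s≤s (length≤-by-cuts n (R ─ e∈) W′
      (suc-injective (≡.trans (length-─ e∈) eq)) (Unique.filter⁺ ≢w? u) cut′))
    where
    ≢w? : Decidable (λ x → ¬ x ≡ w)
    ≢w? x = ¬? (x ≟ᵛ w)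
    W′ = filter ≢w? W
    ⊆w∷W′ : ∀ {x} → x ∈ W → x ∈ w ∷ W′
    ⊆w∷W′ {x} x∈ with x ≟ᵛ w
    ... | yes x≡w = here x≡w
    ... | no x≢w  = there (∈-filter⁺ ≢w? x∈ x≢w)
    -- A set `A` without `w` contains neither end of `e`, so the edge crossing `A` is another one
    -- and survives the deletion.
    cut′ : ∀ A {a} → a ∈ A → (∀ {x} → x ∈ A → x ∈ W′) → ∃ λ e′ → e′ ∈ (R ─ e∈) × Crosses A e′
    cut′ A a∈ A⊆ with e′ , e′∈ , cuts ← cut A a∈ (λ x∈ → proj₁ (∈-filter⁻ ≢w? {xs = W} (A⊆ x∈))) =
      e′ , ∈-─⁺ e∈ (λ where refl → uncut A (λ w∈ → proj₂ (∈-filter⁻ ≢w? {xs = W} (A⊆ w∈)) refl)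
                              (λ x∈ → proj₁ (∈-filter⁻ ≢w? {xs = W} (A⊆ x∈))) cuts) e′∈ , cuts
  proceed : Crosses W e → length W ≤ suc n
  proceed (inj₁ (p∈ , q∉)) = remove _ λ where
    A p∉A A⊆ (inj₁ (p∈A , _)) → p∉A p∈A
    A p∉A A⊆ (inj₂ (_ , q∈A)) → q∉ (A⊆ q∈A)
  proceed (inj₂ (p∉ , q∈)) = remove _ λ where
    A q∉A A⊆ (inj₁ (p∈A , _)) → p∉ (A⊆ p∈A)
    A q∉A A⊆ (inj₂ (_ , q∈A)) → q∉A q∈A

-- If no relation crossed a subset `A` of `W`, isolation would make `A` closed under `Gen R`; but
-- each member is related to a vector outside `W`. So `length≤-by-cuts` applies.
isolated≤presentation : ∀ {g : Vec ℕ k} W → Unique W → (∀ {w} → w ∈ W → Isolated g w) →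
                        (∀ {w} → w ∈ W → ∃ λ b → φ g b ≡ φ g w × b ∉ W) →
                        ∀ R → IsPresentation g R → length W ≤ length R
isolated≤presentation {k} {g} W u isolated root R (sound , complete) = length≤-by-cuts (length R) R W refl u cut
  where
  module _ (A : List (Vec ℕ k)) (A⊆W : ∀ {x} → x ∈ A → x ∈ W) (uncut : ¬ ∃ λ e → e ∈ R × Crosses A e) where
    -- Without one variable of `c`, the isolated vector `a ⊕ c` becomes the only factorization of
    -- its value, and `b ⊕ d` has that value too. Relations translated by `c` are therefore trivial.
    isolated-add : ∀ {a b} c → Gen R a b → a ⊕ c ∈ A → c ≢ 𝟎 → a ≡ b
    isolated-add {a} {b} c gen ac∈ c≢𝟎 with deg c in deg-c
    ... | zero  = contradiction (deg≡0 c deg-c) c≢𝟎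
    ... | suc _ with i , d , refl ← deg≥1 c (≤-trans (s≤s z≤n) (≤-reflexive (≡.sym deg-c))) =
      ⊕-cancelˡ d a b (≡.trans (⊕-comm d a) (≡.trans (≡.sym same) (⊕-comm b d)))
      where
      same : b ⊕ d ≡ a ⊕ d
      same = isolated (A⊆W ac∈) i (a ⊕ d) (⊕-swap a (unit i) d) (b ⊕ d)
        (≡.trans (φ-⊕ g b d) (≡.trans (cong (_+ φ g d) (≡.sym (Gen-sound sound gen))) (≡.sym (φ-⊕ g a d))))
    forth : ∀ {a b} → Gen R a b → a ∈ A → b ∈ A
    back : ∀ {a b} → Gen R a b → b ∈ A → a ∈ A
    forth {b = b} (base ab∈) a∈ with b ∈? A
    ... | yes b∈ = b∈
    ... | no b∉  = contradiction (_ , ab∈ , inj₁ (a∈ , b∉)) uncut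
    forth refl a∈ = a∈
    forth (sym p) a∈ = back p a∈
    forth (trans p q) a∈ = forth q (forth p a∈)
    forth (add {a} {b} p c) ac∈ with c ≟ᵛ 𝟎
    ... | yes refl = subst (_∈ A) (≡.sym (⊕-identityʳ b)) (forth p (subst (_∈ A) (⊕-identityʳ a) ac∈))
    ... | no c≢𝟎   = subst (λ v → v ⊕ c ∈ A) (isolated-add c p ac∈ c≢𝟎) ac∈
    back {a = a} (base ab∈) b∈ with a ∈? A
    ... | yes a∈ = a∈
    ... | no a∉  = contradiction (_ , ab∈ , inj₂ (a∉ , b∈)) uncut
    back refl b∈ = b∈
    back (sym p) b∈ = forth p b∈
    back (trans p q) b∈ = back p (back q b∈)
    back (add {a} {b} p c) bc∈ with c ≟ᵛ 𝟎
    ... | yes refl = subst (_∈ A) (≡.sym (⊕-identityʳ a)) (back p (subst (_∈ A) (⊕-identityʳ b) bc∈))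
    ... | no c≢𝟎   = subst (λ v → v ⊕ c ∈ A) (isolated-add c (sym p) bc∈ c≢𝟎) bc∈
  cut : ∀ A {a} → a ∈ A → (∀ {x} → x ∈ A → x ∈ W) → ∃ λ e → e ∈ R × Crosses A e
  cut A {a} a∈ A⊆ with Any.any? (crosses? A) R
  ... | yes crossing = find crossing
  ... | no none with b , eq , b∉ ← root (A⊆ a∈) =
    contradiction (A⊆ (forth A A⊆ (λ (_ , e∈ , cr) → none (lose e∈ cr)) (complete a b (≡.sym eq)) a∈)) b∉

lookup-unit⊕≢0 : ∀ i (d : Vec ℕ k) → lookup (unit i ⊕ d) i ≢ 0
lookup-unit⊕≢0 i d eq with () ← ≡.trans (≡.sym eq) (≡.trans (lookup-⊕ i (unit i) d) (cong (_+ lookup d i) (lookup-at i 1)))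

-- Quadratic monomials

quadratics : ∀ k → List (Vec ℕ k)
quadratics zero    = []
quadratics (suc k) = map (λ i → unit zero ⊕ unit i) (allFin (suc k)) ++ map (0 ∷_) (quadratics k)

length-quadratics : ∀ k → length (quadratics k) ≡ suc k C 2
length-quadratics zero    = refl
length-quadratics (suc k) = begin
  length (quadratics (suc k))
    ≡⟨ List.length-++ (map (λ i → unit zero ⊕ unit i) (allFin (suc k))) ⟩
  length (map (λ i → unit zero ⊕ unit {suc k} i) (allFin (suc k))) + length (map (0 ∷_) (quadratics k))
    ≡⟨ cong₂ _+_ (length-map-allFin (suc k))
                 (≡.trans (List.length-map _ (quadratics k)) (length-quadratics k)) ⟩
  suc k + suc k C 2
    ≡⟨ cong (_+ suc k C 2) (nC1≡n (suc k)) ⟨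
  suc k C 1 + suc k C 2
    ≡⟨ nCk+nC[k+1]≡[n+1]C[k+1] (suc k) 1 ⟩
  suc (suc k) C 2 ∎
  where open ≡.≡-Reasoning

quadratic⇒units : ∀ {w : Vec ℕ k} → w ∈ quadratics k → ∃₂ λ i j → w ≡ unit i ⊕ unit j
quadratic⇒units {suc k} w∈ with ∈-++⁻ (map (λ i → unit zero ⊕ unit i) (allFin (suc k))) w∈
... | inj₁ w∈′ with i , _ , w≡ ← ∈-map⁻ (λ i → unit zero ⊕ unit i) {xs = allFin (suc k)} w∈′ = zero , i , w≡
... | inj₂ w∈′ with v , v∈ , refl ← ∈-map⁻ (0 ∷_) w∈′ with i , j , refl ← quadratic⇒units v∈ = suc i , suc j , refl

Unique-quadratics : ∀ k → Unique (quadratics k)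
Unique-quadratics zero    = []
Unique-quadratics (suc k) = Unique.++⁺
  (Unique.map⁺ {f = λ i → unit zero ⊕ unit i} (λ {i} {j} eq → unit-injective (⊕-cancelˡ (unit zero) (unit i) (unit j) eq)) (Unique.allFin⁺ (suc k)))
  (Unique.map⁺ Vec.∷-injectiveʳ (Unique-quadratics k))
  disjoint
  where
  disjoint : ∀ {w} → ¬ (w ∈ map (λ i → unit zero ⊕ unit i) (allFin (suc k)) × w ∈ map (0 ∷_) (quadratics k))
  disjoint (w∈ , w∈′) with i , _ , w≡ ← ∈-map⁻ (λ i → unit zero ⊕ unit i) {xs = allFin (suc k)} w∈ with _ , _ , eq ← ∈-map⁻ (0 ∷_) w∈′ =
    lookup-unit⊕≢0 zero (unit i) (cong (λ v → lookup v zero) (≡.trans (≡.sym w≡) eq))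

-- Dividing a product of two variables by a variable leaves a variable, and generators factor
-- uniquely.
quadratic-isolated : ∀ {g : Vec ℕ k} → IsMinGenNumMonoid g → (∀ i → 1 ≤ lookup g i) →
                     ∀ i j → Isolated g (unit i ⊕ unit j)
quadratic-isolated {g = g} minGen pos i j i′ d eq d′ φd′ with unit⊕-cancel i i′ (unit j) d eq
... | inj₁ (refl , refl) = generator-unique minGen pos j d′ (≡.trans φd′ (φ-unit g j))
... | inj₂ (c , refl , ej) with refl ← deg≡0 c (suc-injective (≡.trans (≡.sym (deg-unit⊕ i′ c)) (≡.trans (cong deg (≡.sym ej)) (deg-at j 1)))) =
  ≡.trans (generator-unique minGen pos i d′ (≡.trans φd′ (≡.trans (cong (φ g) (⊕-identityʳ (unit i))) (φ-unit g i)))) (≡.sym (⊕-identityʳ (unit i)))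

-- Cofiniteness, blocks of generators and increasing sequences

window⇒cofinite : ∀ {m} {g′ : Vec ℕ k} ⦃ _ : NonZero m ⦄ N → (∀ {t} → t < m → (N + t) ∈⟨ m ∷ g′ ⟩) →
                  ∀ n → N ≤ n → n ∈⟨ m ∷ g′ ⟩
window⇒cofinite {m = m} {g′} N window n N≤n
  with a , eq ← window (m%n<n (n ∸ N) m) = (at zero q ⊕ a) , (begin-equality
    φ (m ∷ g′) (at zero q ⊕ a)            ≡⟨ φ-⊕ (m ∷ g′) (at zero q) a ⟩
    φ (m ∷ g′) (at zero q) + φ (m ∷ g′) a ≡⟨ cong₂ _+_ (φ-at (m ∷ g′) zero q) eq ⟩
    q * m + (N + (n ∸ N) % m)             ≡⟨ arith (q * m) N ((n ∸ N) % m) ⟩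
    N + ((n ∸ N) % m + q * m)             ≡⟨ cong (N +_) (m≡m%n+[m/n]*n (n ∸ N) m) ⟨
    N + (n ∸ N)                           ≡⟨ m+[n∸m]≡n N≤n ⟩
    n                                     ∎)
  where
  q = (n ∸ N) / m
  open ≤-Reasoning
  arith : ∀ x y z → x + (y + z) ≡ y + (z + x)
  arith = solve-∀

-- Turns division by a variable into a computation, so that conditions on quotients become
-- decidable.
decrement-unit⊕ : ∀ i (d : Vec ℕ k) → (unit i ⊕ d) [ i ]%= pred ≡ d
decrement-unit⊕ zero    (x ∷ d) = cong (x ∷_) (⊕-identityˡ d)
decrement-unit⊕ (suc i) (x ∷ d) = cong (x ∷_) (decrement-unit⊕ i d)

φ-++ : ∀ (g : Vec ℕ k) {h : Vec ℕ l} a {b} → φ (g ++ᵛ h) (a ++ᵛ b) ≡ φ g a + φ h b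
φ-++ []      []              = refl
φ-++ (x ∷ g) (y ∷ a) = ≡.trans (cong (y * x +_) (φ-++ g a)) (≡.sym (+-assoc (y * x) (φ g a) _))

φ-shift : ∀ c (g a : Vec ℕ k) → φ (Vec.map (c +_) g) a ≡ deg a * c + φ g a
φ-shift c []      []      = refl
φ-shift c (x ∷ g) (y ∷ a) = ≡.trans (cong (y * (c + x) +_) (φ-shift c g a)) (arith c x y (deg a) (φ g a))
  where
  arith : ∀ c x y d p → y * (c + x) + (d * c + p) ≡ (y + d) * c + (y * x + p)
  arith = solve-∀

unit-↑ˡ : ∀ (i : Fin k) → unit (i ↑ˡ l) ≡ unit i ++ᵛ 𝟎
unit-↑ˡ {suc k} {l} zero = cong (1 ∷_) (𝟎-++ k)
  where
  𝟎-++ : ∀ k → 𝟎 {k + l} ≡ 𝟎 {k} ++ᵛ 𝟎 {l}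
  𝟎-++ zero    = refl
  𝟎-++ (suc k) = cong (0 ∷_) (𝟎-++ k)
unit-↑ˡ (suc i) = cong (0 ∷_) (unit-↑ˡ i)

units-↑ˡ : ∀ (i j : Fin k) → unit (i ↑ˡ l) ⊕ unit (j ↑ˡ l) ≡ (unit i ⊕ unit j) ++ᵛ 𝟎
units-↑ˡ i j = ≡.trans (cong₂ _⊕_ (unit-↑ˡ i) (unit-↑ˡ j))
              (≡.trans (Vec.zipWith-++ _+_ (unit i) 𝟎 (unit j) 𝟎) (cong ((unit i ⊕ unit j) ++ᵛ_) (⊕-identityˡ 𝟎)))

divide-++𝟎 : ∀ (c : Vec ℕ k) i (d : Vec ℕ (k + l)) → c ++ᵛ 𝟎 ≡ unit i ⊕ d →
             ∃₂ λ i′ d′ → c ≡ unit i′ ⊕ d′ × d ≡ d′ ++ᵛ 𝟎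
divide-++𝟎 []      i       d       eq = contradiction (≡.sym eq) (unit⊕≢𝟎 i d)
divide-++𝟎 (x ∷ c) zero    (y ∷ d) eq = zero , (y ∷ c)
  , cong₂ _∷_ (Vec.∷-injectiveˡ eq) (≡.sym (⊕-identityˡ c))
  , cong (y ∷_) (≡.trans (≡.sym (⊕-identityˡ d)) (≡.sym (Vec.∷-injectiveʳ eq)))
divide-++𝟎 (x ∷ c) (suc i) (y ∷ d) eq with refl ← Vec.∷-injectiveˡ eq
  with i′ , d′ , c≡ , d≡ ← divide-++𝟎 c i d (Vec.∷-injectiveʳ eq) =
  suc i′ , (x ∷ d′) , cong (x ∷_) c≡ , cong (x ∷_) d≡

-- lo ≤ x₁ < x₂ < ⋯ < xₖ < hi (or lo ≤ hi, if k = 0).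
Between : ℕ → Vec ℕ k → ℕ → Set
Between lo []      hi = lo ≤ hi
Between lo (x ∷ v) hi = lo ≤ x × Between (suc x) v hi

between? : ∀ lo (v : Vec ℕ k) hi → Dec (Between lo v hi)
between? lo []      hi = lo ≤? hi
between? lo (x ∷ v) hi = (lo ≤? x) ×-dec between? (suc x) v hi

Between-weaken : ∀ {lo lo′ hi} (v : Vec ℕ k) → lo′ ≤ lo → Between lo v hi → Between lo′ v hi
Between-weaken []      lo≤ lo≤hi     = ≤-trans lo≤ lo≤hi
Between-weaken (x ∷ v) lo≤ (lo≤x , b) = ≤-trans lo≤ lo≤x , b

Between-++ : ∀ {lo mid hi} (v : Vec ℕ k) {w : Vec ℕ l} → Between lo v mid → Between mid w hi → Between lo (v ++ᵛ w) hi
Between-++ []      lo≤      bw = Between-weaken _ lo≤ bw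
Between-++ (x ∷ v) (lo≤ , bv) bw = lo≤ , Between-++ v bv bw

Between-shift : ∀ c {lo hi} (v : Vec ℕ k) → Between lo v hi → Between (c + lo) (Vec.map (c +_) v) (c + hi)
Between-shift c []      lo≤       = +-monoʳ-≤ c lo≤
Between-shift c {hi = hi} (x ∷ v) (lo≤ , bv) = +-monoʳ-≤ c lo≤
  , subst (λ y → Between y (Vec.map (c +_) v) (c + hi)) (+-suc c x) (Between-shift c v bv)

Between⇒< : ∀ {lo hi} (v : Vec ℕ k) → Between lo v hi → ∀ i → lookup v i < hi
Between⇒≤ : ∀ {lo hi} (v : Vec ℕ k) → Between lo v hi → ∀ i → lo ≤ lookup v i
Between⇒≤ (x ∷ v) (lo≤ , bv) zero    = lo≤
Between⇒≤ (x ∷ v) (lo≤ , bv) (suc i) = ≤-trans lo≤ (<⇒≤ (Between⇒≤ v bv i))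
Between⇒< (x ∷ [])    (lo≤ , x<) zero    = x<
Between⇒< (x ∷ y ∷ v) (lo≤ , x< , bv) zero = <-trans x< (Between⇒< (y ∷ v) (≤-refl , bv) zero)
Between⇒< (x ∷ v)     (lo≤ , bv) (suc i) = Between⇒< v bv i

Between⇒increasing : ∀ {lo hi} (v : Vec ℕ k) → Between lo v hi → ∀ i j → i Fin.< j → lookup v i < lookup v j
Between⇒increasing (x ∷ v) (lo≤ , bv) zero    (suc j) _         = Between⇒≤ v bv j
Between⇒increasing (x ∷ v) (lo≤ , bv) (suc i) (suc j) (s≤s i<j) = Between⇒increasing v bv i j i<j

run : ∀ n → ℕ → Vec ℕ n
run zero    x = []
run (suc n) x = x ∷ run n (suc x)

Between-run : ∀ n x → Between x (run n x) (x + n)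
Between-run zero    x = ≤-reflexive (≡.sym (+-identityʳ x))
Between-run (suc n) x = ≤-refl , subst (Between (suc x) (run n (suc x))) (≡.sym (+-suc x n)) (Between-run n (suc x))

∈-run : ∀ n x {t} → t < n → ∃ λ i → lookup (run n x) i ≡ x + t
∈-run (suc n) x {zero}  _         = zero , ≡.sym (+-identityʳ x)
∈-run (suc n) x {suc t} (s≤s t<n) with i , eq ← ∈-run n (suc x) t<n = suc i , ≡.trans eq (≡.sym (+-suc x t))

Extremal : ℕ → ℕ → Set
Extremal e s = ∃ λ (g : Vec ℕ (suc e)) → IsMinGenNumMonoid g × Vec.head g ≡ suc (e + s) ×
                 ∀ R → IsPresentation g R → suc e C 2 + F s ≤ length R + s

-- The extremal monoids

-- With m = K + n, the generators are m + O, the interval [m + K, 2m) and 2m + E.  Every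
-- integer ≥ m + K lies in the monoid.  P lists the standard quadratic monomials and Q the cubic
-- minimal monomials outside the standard ones, both as exponent vectors over m + O.
module Design {p q} (K s : ℕ) (O : Vec ℕ (suc p)) (E : Vec ℕ q) (P Q : List (Vec ℕ (suc p))) where

  -- A finite test for unique factorization, see `rigid⇒unique`: in the range from `2m` to `2m + K`,
  -- only the generators `2m + E` and sums of two generators `m + O` compete.
  Rigid : Vec ℕ (suc p) → Set
  Rigid d = deg d ≡ 2 × φ O d < K × (∀ x → lookup E x ≢ φ O d) ×
            (∀ i j → lookup O i + lookup O j ≡ φ O d → unit i ⊕ unit j ≡ d)

  Corner : Vec ℕ (suc p) → Set
  Corner c = deg c ≡ 3 × lookup c zero ≡ 0 × ∀ i → lookup c i ≡ 0 ⊎ Rigid (c [ i ]%= pred)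

  Sum : ℕ → Set
  Sum σ = ∃₂ λ i j → lookup O i + lookup O j ≡ σ

  Covered : ℕ → Set
  Covered σ = (∃ λ x → lookup E x ≡ σ) ⊎ Sum σ

  -- All conditions concern offsets and do not mention `n`, so one evaluation serves an infinite
  -- family.
  record Valid : Set where
    constructor valid
    field
      -- With `e = p + n + q` this turns `m = K + n` into `e + s + 1`.
      size      : suc (p + q + s) ≡ K
      length-P  : length P ≡ s
      length-Q  : length Q ≡ F s
      O₀        : lookup O zero ≡ 0
      Between-O : Between 0 O K
      Between-E : Between 0 E K
      E-new     : ∀ x → ¬ Sum (lookup E x)
      covers    : ∀ σ → Covered (Fin.toℕ {K} σ)
      -- A product below `2m + K` is listed in `P`, or its offset sum is again an offset, which
      -- gives a factorization with the multiplicity.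
      P-light   : ∀ i j → i ≢ zero → j ≢ zero → lookup O i + lookup O j < K →
                  unit i ⊕ unit j ∈ P ⊎ ∃ λ h → lookup O h ≡ lookup O i + lookup O j
      Unique-Q  : Unique Q
      corners-Q : All Corner Q

  valid? : Dec Valid
  valid? = map′ (λ (a , b , c , d , e , f , g , h , i , j , k) → valid a b c d e f g h i j k)
                (λ (valid a b c d e f g h i j k) → a , b , c , d , e , f , g , h , i , j , k)
    ((suc (p + q + s) ≟ K) ×-dec (length P ≟ s) ×-dec (length Q ≟ F s) ×-dec (lookup O zero ≟ 0)
     ×-dec between? 0 O K ×-dec between? 0 E K
     ×-dec Fin.all? (λ x → ¬? (sum? (lookup E x)))
     ×-dec Fin.all? (λ σ → Fin.any? (λ x → lookup E x ≟ Fin.toℕ σ) ⊎-dec sum? (Fin.toℕ σ))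
     ×-dec Fin.all? (λ i → Fin.all? λ j → ¬? (i Fin.≟ zero) →-dec (¬? (j Fin.≟ zero) →-dec
             ((lookup O i + lookup O j <? K) →-dec
               ((unit i ⊕ unit j) ∈? P ⊎-dec Fin.any? (λ h → lookup O h ≟ lookup O i + lookup O j)))))
     ×-dec unique? _≟ᵛ_ Q ×-dec All.all? corner? Q)
    where
    sum? : Decidable Sum
    sum? σ = Fin.any? λ i → Fin.any? λ j → lookup O i + lookup O j ≟ σ
    rigid? : Decidable Rigid
    rigid? d = (deg d ≟ 2) ×-dec (φ O d <? K) ×-dec Fin.all? (λ x → ¬? (lookup E x ≟ φ O d))
       ×-dec Fin.all? (λ i → Fin.all? λ j → (lookup O i + lookup O j ≟ φ O d) →-dec (unit i ⊕ unit j ≟ᵛ d))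
    corner? : Decidable Corner
    corner? c = (deg c ≟ 3) ×-dec (lookup c zero ≟ 0) ×-dec Fin.all? (λ i → (lookup c i ≟ 0) ⊎-dec rigid? (c [ i ]%= pred))

  module Family (isValid : Valid) (n : ℕ) where

    open Valid isValid

    m N e : ℕ
    m = K + n
    N = n + q
    e = p + N

    K≤m : K ≤ m
    K≤m = m≤m+n K n

    m≥1 : 1 ≤ m
    m≥1 = ≤-trans (s≤s z≤n) (≤-trans (≤-reflexive size) K≤m)

    instance
      m-nonZero : NonZero m
      m-nonZero = >-nonZero m≥1

    small : Vec ℕ (suc p)
    small = Vec.map (m +_) O

    large : Vec ℕ N
    large = run n (m + K) ++ᵛ Vec.map (m + m +_) E

    g : Vec ℕ (suc e)
    g = small ++ᵛ large

    Between-run′ : Between (m + K) (run n (m + K)) (m + m)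
    Between-run′ = subst (Between (m + K) (run n (m + K))) (+-assoc m K n) (Between-run n (m + K))

    Between-large : Between (m + K) large (m + m + K)
    Between-large = Between-++ (run n (m + K)) Between-run′
      (subst (λ x → Between x (Vec.map (m + m +_) E) (m + m + K)) (+-identityʳ (m + m)) (Between-shift (m + m) E Between-E))

    Between-g : Between m g (m + m + K)
    Between-g = Between-++ small
      (subst (λ x → Between x small (m + K)) (+-identityʳ m) (Between-shift m O Between-O)) Between-large

    lookup-small : ∀ i → lookup g (i ↑ˡ N) ≡ m + lookup O i
    lookup-small i = ≡.trans (Vec.lookup-++ˡ small large i) (Vec.lookup-map i (m +_) O)

    index : ∀ i → (∃ λ i′ → i ≡ i′ ↑ˡ N × lookup g i ≡ m + lookup O i′) ⊎ (∃ λ j → lookup g i ≡ lookup large j)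
    index i with splitAt (suc p) i in eq
    ... | inj₁ i′ with refl ← Fin.splitAt⁻¹-↑ˡ {suc p} {i = i} eq = inj₁ (i′ , refl , lookup-small i′)
    ... | inj₂ j  with refl ← Fin.splitAt⁻¹-↑ʳ {suc p} {i = i} eq = inj₂ (j , Vec.lookup-++ʳ small large j)

    m≤g : ∀ i → m ≤ lookup g i
    m≤g = Between⇒≤ g Between-g

    g<2m+K : ∀ i → lookup g i < m + m + K
    g<2m+K = Between⇒< g Between-g

    g-increasing : ∀ i j → i Fin.< j → lookup g i < lookup g j
    g-increasing = Between⇒increasing g Between-g

    g-injective : ∀ i j → lookup g i ≡ lookup g j → i ≡ j
    g-injective i j eq with Fin.<-cmp i j
    ... | tri< i<j _ _ = contradiction eq (<⇒≢ (g-increasing i j i<j))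
    ... | tri≈ _ i≡j _ = i≡j
    ... | tri> _ _ j<i = contradiction (≡.sym eq) (<⇒≢ (g-increasing j i j<i))

    value : ∀ i → lookup g i < m + m ⊎ ∃ λ x → lookup g i ≡ m + m + lookup E x
    value i with index i
    ... | inj₁ (i′ , _ , eq) = inj₁ (≤-trans (≤-reflexive (cong suc eq)) (+-monoʳ-< m (≤-trans (Between⇒< O Between-O i′) K≤m)))
    ... | inj₂ (j , eq) with splitAt n j in split
    ...   | inj₁ j′ with refl ← Fin.splitAt⁻¹-↑ˡ {n} {i = j} split =
      inj₁ (≤-trans (≤-reflexive (cong suc (≡.trans eq (Vec.lookup-++ˡ (run n (m + K)) _ j′)))) (Between⇒< (run n (m + K)) Between-run′ j′))
    ...   | inj₂ x with refl ← Fin.splitAt⁻¹-↑ʳ {n} {i = j} split =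
      inj₂ (x , ≡.trans eq (≡.trans (Vec.lookup-++ʳ (run n (m + K)) _ x) (Vec.lookup-map x (m + m +_) E)))

    regroup : ∀ m x y → m + x + (m + y) ≡ m + m + (x + y)
    regroup = solve-∀

    reorder : ∀ m K → m + K + m ≡ m + m + K
    reorder = solve-∀

    -- A generator beyond the first block is at least `m + K`, so with any second generator the sum
    -- reaches `2m + K`.
    light-pair : ∀ i j → lookup g i + lookup g j < m + m + K →
                 ∃₂ λ i′ j′ → i ≡ i′ ↑ˡ N × j ≡ j′ ↑ˡ N
                   × lookup g i + lookup g j ≡ m + m + (lookup O i′ + lookup O j′) × lookup O i′ + lookup O j′ < K
    light-pair i j light with index i | index j
    ... | inj₁ (i′ , i≡ , gi) | inj₁ (j′ , j≡ , gj) = i′ , j′ , i≡ , j≡ , sum≡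
          , +-cancelˡ-< (m + m) _ _ (≤-trans (≤-reflexive (cong suc (≡.sym sum≡))) light)
      where
      sum≡ : lookup g i + lookup g j ≡ m + m + (lookup O i′ + lookup O j′)
      sum≡ = ≡.trans (cong₂ _+_ gi gj) (regroup m (lookup O i′) (lookup O j′))
    ... | inj₂ (h , gi) | _ = contradiction light (≤⇒≯ (≤-trans (≤-reflexive (≡.sym (reorder m K)))
          (+-mono-≤ (≤-trans (Between⇒≤ large Between-large h) (≤-reflexive (≡.sym gi))) (m≤g j))))
    ... | inj₁ _ | inj₂ (h , gj) = contradiction light (≤⇒≯ (≤-trans (≤-reflexive (+-assoc m m K))
          (+-mono-≤ (m≤g i) (≤-trans (Between⇒≤ large Between-large h) (≤-reflexive (≡.sym gj))))))

    φ-units : ∀ i j → φ g (unit i ⊕ unit j) ≡ lookup g i + lookup g j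
    φ-units i j = ≡.trans (φ-unit⊕ g i (unit j)) (cong (lookup g i +_) (φ-unit g j))

    -- Three generators sum to at least `3m`, which is not below `2m + K` because `K ≤ m`.
    light-deg : ∀ a → φ g a < m + m + K → deg a ≤ 2
    light-deg a light = s≤s⁻¹ (*-cancelʳ-< m (deg a) 3 (≤-trans (s≤s (deg*≤φ g m m≤g a))
      (≤-trans light (≤-trans (+-monoʳ-≤ (m + m) K≤m) (≤-reflexive (arith m))))))
      where
      arith : ∀ m → m + m + m ≡ 3 * m
      arith = solve-∀

    -- All generators are below `2m + K`, so a competing factorization has degree at most 2. In
    -- degree 2 it reaches `2m`, which leaves the generators `2m + E`, excluded by `E-new`.
    g-minimal : ∀ i → ¬ ∃ λ a → lookup a i ≡ 0 × φ g a ≡ lookup g i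
    g-minimal i (a , a_i , eq) with deg a in deg-a | light-deg a (≤-trans (≤-reflexive (cong suc eq)) (g<2m+K i))
    ... | 0 | _ with refl ← deg≡0 a deg-a = contradiction (≤-trans m≥1 (m≤g i)) (<⇒≱ (≤-reflexive (cong suc (≡.trans (≡.sym eq) (φ-𝟎 g)))))
    ... | 1 | _ with j , refl ← deg≡1 a deg-a with refl ← g-injective j i (≡.trans (≡.sym (φ-unit g j)) eq) =
      contradiction (≡.trans (≡.sym (lookup-at j 1)) a_i) λ ()
    ... | 2 | _ with j , h , refl ← deg≡2 a deg-a with gj+gh ← ≡.trans (≡.sym (φ-units j h)) eq with value i
    ...   | inj₁ gi<2m = contradiction (≤-trans (≤-reflexive (cong suc gj+gh)) gi<2m) (≤⇒≯ (+-mono-≤ (m≤g j) (m≤g h)))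
    ...   | inj₂ (x , gi) with j′ , h′ , _ , _ , sum≡ , _ ← light-pair j h (≤-trans (≤-reflexive (cong suc gj+gh)) (g<2m+K i)) =
      E-new x (j′ , h′ , +-cancelˡ-≡ (m + m) _ _ (≡.trans (≡.sym sum≡) (≡.trans gj+gh gi)))
    g-minimal i (a , a_i , eq) | suc (suc (suc _)) | s≤s (s≤s ())

    window : ∀ {t} → t < m → (m + K + t) ∈⟨ g ⟩
    window {t} t<m with t <? n
    ... | yes t<n with j , eq ← ∈-run n (m + K) t<n = unit (suc p ↑ʳ (j ↑ˡ q))
          , ≡.trans (φ-unit g _) (≡.trans (Vec.lookup-++ʳ small large (j ↑ˡ q)) (≡.trans (Vec.lookup-++ˡ (run n (m + K)) _ j) eq))
    ... | no t≮n = generated (subst Covered (Fin.toℕ-fromℕ< σ<K) (covers (Fin.fromℕ< σ<K)))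
      where
      -- Past the interval from `m + K` to `2m`, of length `n`, the integer `m + K + t` is `2m + σ`
      -- with `σ < K`, where `covers` applies.
      σ = t ∸ n
      σ<K : σ < K
      σ<K = +-cancelˡ-< n σ K (≤-trans (≤-reflexive (cong suc (m+[n∸m]≡n (≮⇒≥ t≮n)))) (≤-trans t<m (≤-reflexive (+-comm K n))))
      arith : ∀ K n σ → K + n + (K + n) + σ ≡ K + n + K + (n + σ)
      arith = solve-∀
      m+m+σ : m + m + σ ≡ m + K + t
      m+m+σ = ≡.trans (arith K n σ) (cong (m + K +_) (m+[n∸m]≡n (≮⇒≥ t≮n)))
      generated : Covered σ → (m + K + t) ∈⟨ g ⟩
      generated (inj₁ (x , eq)) = unit (suc p ↑ʳ (n ↑ʳ x))
        , ≡.trans (φ-unit g _) (≡.trans (Vec.lookup-++ʳ small large (n ↑ʳ x)) (≡.trans (Vec.lookup-++ʳ (run n (m + K)) _ x)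
            (≡.trans (Vec.lookup-map x (m + m +_) E) (≡.trans (cong (m + m +_) eq) m+m+σ))))
      generated (inj₂ (i , j , eq)) = unit (i ↑ˡ N) ⊕ unit (j ↑ˡ N)
        , ≡.trans (φ-units _ _) (≡.trans (cong₂ _+_ (lookup-small i) (lookup-small j))
            (≡.trans (regroup m (lookup O i) (lookup O j)) (≡.trans (cong (m + m +_) eq) m+m+σ)))

    g₀ : lookup g zero ≡ m
    g₀ = ≡.trans (lookup-small zero) (≡.trans (cong (m +_) O₀) (+-identityʳ m))

    cofinite : ∀ x → m + K ≤ x → x ∈⟨ g ⟩
    cofinite = go g g₀ window
      where
      -- The first entry of `g` equals `m` only through `g₀`; generalizing `g` to `h` allows
      -- matching on that equation.
      go : ∀ (h : Vec ℕ (suc e)) → lookup h zero ≡ m → (∀ {t} → t < m → (m + K + t) ∈⟨ h ⟩) → ∀ x → m + K ≤ x → x ∈⟨ h ⟩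
      go (_ ∷ _) refl w = window⇒cofinite (m + K) w

    minGen : IsMinGenNumMonoid g
    minGen = g-increasing , g-minimal , m + K , cofinite

    g≥1 : ∀ i → 1 ≤ lookup g i
    g≥1 i = ≤-trans m≥1 (m≤g i)

    pad : Vec ℕ (suc p) → Vec ℕ (suc e)
    pad c = c ++ᵛ 𝟎

    φ-pad : ∀ c → φ g (pad c) ≡ deg c * m + φ O c
    φ-pad c = ≡.trans (φ-++ small c) (≡.trans (cong (φ small c +_) (φ-𝟎 large)) (≡.trans (+-identityʳ _) (φ-shift m O c)))

    rigid⇒unique : ∀ d → Rigid d → ∀ a → φ g a ≡ φ g (pad d) → a ≡ pad d
    rigid⇒unique d (deg-d , φd<K , φd∉E , unique) a eq = go (deg a) refl (light-deg a light)
      where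
      arith : ∀ m → 2 * m ≡ m + m
      arith = solve-∀
      φa : φ g a ≡ m + m + φ O d
      φa = ≡.trans eq (≡.trans (φ-pad d) (cong (_+ φ O d) (≡.trans (cong (_* m) deg-d) (arith m))))
      light : φ g a < m + m + K
      light = ≤-trans (≤-reflexive (cong suc φa)) (+-monoʳ-< (m + m) φd<K)
      2m≤φa : m + m ≤ φ g a
      2m≤φa = ≤-trans (m≤m+n (m + m) (φ O d)) (≤-reflexive (≡.sym φa))
      go : ∀ x → deg a ≡ x → x ≤ 2 → a ≡ pad d
      go 0 deg-a _ with refl ← deg≡0 a deg-a =
        contradiction (≤-trans m≥1 (≤-trans (m≤m+n m m) 2m≤φa)) (<⇒≱ (≤-reflexive (cong suc (φ-𝟎 g))))
      go 1 deg-a _ with i , refl ← deg≡1 a deg-a with value i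
      ... | inj₁ <2m = contradiction (≤-trans (≤-reflexive (cong suc (φ-unit g i))) <2m) (≤⇒≯ 2m≤φa)
      ... | inj₂ (x , gi) = contradiction (+-cancelˡ-≡ (m + m) _ _ (≡.trans (≡.sym gi) (≡.trans (≡.sym (φ-unit g i)) φa))) (φd∉E x)
      go 2 deg-a _ with i , j , refl ← deg≡2 a deg-a
        with i′ , j′ , refl , refl , sum≡ , _ ← light-pair i j (≤-trans (≤-reflexive (cong suc (≡.sym (φ-units i j)))) light) =
        ≡.trans (units-↑ˡ i′ j′) (cong pad (unique i′ j′
          (+-cancelˡ-≡ (m + m) _ _ (≡.trans (≡.sym sum≡) (≡.trans (≡.sym (φ-units i j)) φa)))))
      go (suc (suc (suc _))) _ (s≤s (s≤s ()))

    corner-isolated : ∀ {c} → Corner c → Isolated g (pad c)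
    corner-isolated {c} (_ , _ , rigid) i d eq d′ φd′ with i′ , d₀ , refl , refl ← divide-++𝟎 c i d eq with rigid i′
    ... | inj₁ c_i≡0 = contradiction c_i≡0 (lookup-unit⊕≢0 i′ d₀)
    ... | inj₂ r = rigid⇒unique d₀ (subst Rigid (decrement-unit⊕ i′ d₀) r) d′ φd′

    Rooted : Vec ℕ (suc e) → Set
    Rooted w = ∃ λ b → φ g (unit zero ⊕ b) ≡ φ g w

    -- After one copy of `m` is removed, the value is still at least `m + K`, where `cofinite`
    -- applies.
    heavy⇒Rooted : ∀ w → m + m + K ≤ φ g w → Rooted w
    heavy⇒Rooted w heavy with b , eq ← cofinite (φ g w ∸ m) (m+n≤o⇒m≤o∸n (m + K) (≤-trans (≤-reflexive (reorder m K)) heavy)) =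
      b , ≡.trans (φ-unit⊕ g zero b) (≡.trans (cong₂ _+_ g₀ eq) (m+[n∸m]≡n (≤-trans (≤-trans (m≤m+n m m) (m≤m+n (m + m) K)) heavy)))

    padded? : ∀ w → Dec (w ∈ map pad P)
    padded? w = w ∈? map pad P

    quadrics cubics W : List (Vec ℕ (suc e))
    quadrics = map (0 ∷_) (quadratics e)
    cubics = map pad Q
    W = filter (¬? ∘ padded?) quadrics ++ cubics

    quadric⇒units : ∀ {w} → w ∈ quadrics → ∃₂ λ i j → w ≡ unit (suc i) ⊕ unit (suc j)
    quadric⇒units w∈ with v , v∈ , refl ← ∈-map⁻ (0 ∷_) w∈ with i , j , refl ← quadratic⇒units v∈ = i , j , refl

    -- Heavy products contain a copy of `m` by `heavy⇒Rooted`. For a light one outside `P`, the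
    -- offset sum is an offset, so the value is `m` plus a generator of the first block.
    quadric-rooted : ∀ {w} → w ∈ quadrics → w ∉ map pad P → Rooted w
    quadric-rooted w∈ w∉ with i , j , refl ← quadric⇒units w∈ with m + m + K ≤? φ g (unit (suc i) ⊕ unit (suc j))
    ... | yes heavy = heavy⇒Rooted (unit (suc i) ⊕ unit (suc j)) heavy
    ... | no light with i′ , j′ , i≡ , j≡ , sum≡ , sum<K ← light-pair (suc i) (suc j)
                          (≤-trans (≤-reflexive (cong suc (≡.sym (φ-units (suc i) (suc j))))) (≰⇒> light))
                   with P-light i′ j′ (λ where refl → contradiction i≡ λ ()) (λ where refl → contradiction j≡ λ ()) sum<K
    ...   | inj₁ ij∈P = contradiction (subst (_∈ map pad P)
              (≡.trans (≡.sym (units-↑ˡ i′ j′)) (≡.sym (cong₂ (λ x y → unit x ⊕ unit y) i≡ j≡))) (∈-map⁺ pad ij∈P)) w∉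
    ...   | inj₂ (h , O_h) = unit (h ↑ˡ N) , (begin-equality
              φ g (unit zero ⊕ unit (h ↑ˡ N))              ≡⟨ φ-units zero (h ↑ˡ N) ⟩
              lookup g zero + lookup g (h ↑ˡ N)            ≡⟨ cong₂ _+_ g₀ (lookup-small h) ⟩
              m + (m + lookup O h)                         ≡⟨ +-assoc m m _ ⟨
              m + m + lookup O h                           ≡⟨ cong (m + m +_) O_h ⟩
              m + m + (lookup O i′ + lookup O j′)          ≡⟨ sum≡ ⟨
              lookup g (suc i) + lookup g (suc j)          ≡⟨ φ-units (suc i) (suc j) ⟨
              φ g (unit (suc i) ⊕ unit (suc j))            ∎)
      where open ≤-Reasoning

    cubic⇒corner : ∀ {w} → w ∈ cubics → ∃ λ c → Corner c × w ≡ pad c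
    cubic⇒corner w∈ with c , c∈ , w≡ ← ∈-map⁻ pad w∈ = c , All.lookup corners-Q c∈ , w≡

    cubic-rooted : ∀ {w} → w ∈ cubics → Rooted w
    cubic-rooted w∈ with c , (deg-c , _) , refl ← cubic⇒corner w∈ = heavy⇒Rooted (pad c) (begin
      m + m + K         ≤⟨ +-monoʳ-≤ (m + m) K≤m ⟩
      m + m + m         ≡⟨ arith m ⟩
      3 * m             ≡⟨ cong (_* m) deg-c ⟨
      deg c * m         ≤⟨ m≤m+n _ _ ⟩
      deg c * m + φ O c ≡⟨ φ-pad c ⟨
      φ g (pad c)       ∎)
      where
      open ≤-Reasoning
      arith : ∀ m → m + m + m ≡ 3 * m
      arith = solve-∀

    W-split : ∀ {w} → w ∈ W → (w ∈ quadrics × w ∉ map pad P) ⊎ w ∈ cubics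
    W-split w∈ with ∈-++⁻ (filter (¬? ∘ padded?) quadrics) w∈
    ... | inj₁ w∈′ = inj₁ (∈-filter⁻ (¬? ∘ padded?) {xs = quadrics} w∈′)
    ... | inj₂ w∈′ = inj₂ w∈′

    W-isolated : ∀ {w} → w ∈ W → Isolated g w
    W-isolated w∈ with W-split w∈
    ... | inj₁ (w∈′ , _) with i , j , refl ← quadric⇒units w∈′ = quadratic-isolated minGen g≥1 (suc i) (suc j)
    ... | inj₂ w∈′ with c , corner , refl ← cubic⇒corner w∈′ = corner-isolated corner

    W-head : ∀ {w} → w ∈ W → lookup w zero ≡ 0
    W-head w∈ with W-split w∈
    ... | inj₁ (w∈′ , _) with i , j , refl ← quadric⇒units w∈′ = refl
    ... | inj₂ w∈′ with c , (_ , c₀ , _) , refl ← cubic⇒corner w∈′ = ≡.trans (Vec.lookup-++ˡ c 𝟎 zero) c₀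

    W-rooted : ∀ {w} → w ∈ W → ∃ λ b → φ g b ≡ φ g w × b ∉ W
    W-rooted {w} w∈ with rooted
      where
      rooted : Rooted w
      rooted with W-split w∈
      ... | inj₁ (w∈′ , w∉) = quadric-rooted w∈′ w∉
      ... | inj₂ w∈′        = cubic-rooted w∈′
    ... | b , eq = unit zero ⊕ b , eq , λ b∈ → lookup-unit⊕≢0 zero b (W-head b∈)

    Unique-quadrics : Unique quadrics
    Unique-quadrics = Unique.map⁺ Vec.∷-injectiveʳ (Unique-quadratics e)

    Unique-W : Unique W
    Unique-W = Unique.++⁺ (Unique.filter⁺ (¬? ∘ padded?) Unique-quadrics)
      (Unique.map⁺ (λ {c} {c′} → Vec.++-injectiveˡ c c′) Unique-Q) disjoint
      where
      disjoint : ∀ {w} → ¬ (w ∈ filter (¬? ∘ padded?) quadrics × w ∈ cubics)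
      disjoint (w∈ , w∈′) with i , j , w≡ ← quadric⇒units (proj₁ (∈-filter⁻ (¬? ∘ padded?) {xs = quadrics} w∈))
                          with c , (deg-c , _) , refl ← cubic⇒corner w∈′ = contradiction (begin-equality
        3                                ≡⟨ deg-c ⟨
        deg c                            ≡⟨ +-identityʳ (deg c) ⟨
        deg c + 0                        ≡⟨ cong (deg c +_) (deg-𝟎 N) ⟨
        deg c + deg (𝟎 {N})              ≡⟨ Vec.sum-++ {ys = 𝟎 {N}} c ⟨
        deg (pad c)                      ≡⟨ cong deg w≡ ⟩
        deg (unit (suc i) ⊕ unit (suc j)) ≡⟨ deg-unit⊕ (suc i) (unit (suc j)) ⟩
        suc (deg (unit (suc j)))         ≡⟨ cong suc (deg-at (suc j) 1) ⟩
        2                                ∎) λ ()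
        where open ≤-Reasoning

    -- At most `s` quadratic monomials are lost to `P`, while `F s` cubic ones are gained.
    length-W : suc e C 2 + F s ≤ length W + s
    length-W = begin
      suc e C 2 + F s
        ≡⟨ cong₂ _+_ (≡.trans (List.length-map _ (quadratics e)) (length-quadratics e)) (≡.trans (List.length-map pad Q) length-Q) ⟨
      length quadrics + length cubics
        ≡⟨ cong (_+ length cubics) (length-filter+ padded? quadrics) ⟨
      length (filter padded? quadrics) + length (filter (¬? ∘ padded?) quadrics) + length cubics
        ≤⟨ +-monoˡ-≤ (length cubics) (+-monoˡ-≤ (length (filter (¬? ∘ padded?) quadrics)) (length-⊆ (Unique.filter⁺ padded? Unique-quadrics)
             (λ w∈ → proj₂ (∈-filter⁻ padded? {xs = quadrics} w∈)))) ⟩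
      length (map pad P) + length (filter (¬? ∘ padded?) quadrics) + length cubics
        ≡⟨ cong (λ x → x + length (filter (¬? ∘ padded?) quadrics) + length cubics) (≡.trans (List.length-map pad P) length-P) ⟩
      s + length (filter (¬? ∘ padded?) quadrics) + length cubics
        ≡⟨ arith s (length (filter (¬? ∘ padded?) quadrics)) (length cubics) ⟩
      length (filter (¬? ∘ padded?) quadrics) + length cubics + s
        ≡⟨ cong (_+ s) (List.length-++ (filter (¬? ∘ padded?) quadrics)) ⟨
      length W + s ∎
      where
      open ≤-Reasoning
      arith : ∀ s x y → s + x + y ≡ x + y + s
      arith = solve-∀

    extremal : Extremal e s
    extremal = g , minGen , ≡.trans (head≡lookup g) (≡.trans g₀ m≡)
             , λ R pres → ≤-trans length-W (+-monoˡ-≤ s (isolated≤presentation W Unique-W W-isolated W-rooted R pres))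
      where
      head≡lookup : ∀ (h : Vec ℕ (suc e)) → Vec.head h ≡ lookup h zero
      head≡lookup (_ ∷ _) = refl
      arith : ∀ p q s n → suc (p + q + s) + n ≡ suc (p + (n + q) + s)
      arith = solve-∀
      m≡ : m ≡ suc (e + s)
      m≡ = ≡.trans (cong (_+ n) (≡.sym size)) (arith p q s n)

module _ where
  open Design

  extremal₀ : ∀ n → Extremal (n + 0) 0
  extremal₀ = Family.extremal 1 0 (0 ∷ []) [] [] [] (from-yes (valid? 1 0 (0 ∷ []) [] [] []))

  extremal₁ : ∀ n → Extremal (1 + (n + 0)) 1
  extremal₁ = Family.extremal 3 1 O [] P Q (from-yes (valid? 3 1 O [] P Q))
    where
    O = 0 ∷ 1 ∷ []
    P = (0 ∷ 2 ∷ []) ∷ []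
    Q = (0 ∷ 3 ∷ []) ∷ []

  extremal₂ : ∀ n → Extremal (2 + (n + 0)) 2
  extremal₂ = Family.extremal 5 2 O [] P Q (from-yes (valid? 5 2 O [] P Q))
    where
    O = 0 ∷ 1 ∷ 3 ∷ []
    P = (0 ∷ 2 ∷ 0 ∷ []) ∷ (0 ∷ 1 ∷ 1 ∷ []) ∷ []
    Q = (0 ∷ 3 ∷ 0 ∷ []) ∷ (0 ∷ 2 ∷ 1 ∷ []) ∷ []

  -- The offsets 1 and 3 have distinct pair sums 2, 4, 6, so all cubic monomials in these two
  -- variables are corners. The number 5 is no sum of two offsets and enters through `E`.
  extremal₃ : ∀ n → Extremal (2 + (n + 1)) 3
  extremal₃ = Family.extremal 7 3 O E P Q (from-yes (valid? 7 3 O E P Q))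
    where
    O = 0 ∷ 1 ∷ 3 ∷ []
    E = 5 ∷ []
    P = (0 ∷ 2 ∷ 0 ∷ []) ∷ (0 ∷ 1 ∷ 1 ∷ []) ∷ (0 ∷ 0 ∷ 2 ∷ []) ∷ []
    Q = (0 ∷ 3 ∷ 0 ∷ []) ∷ (0 ∷ 2 ∷ 1 ∷ []) ∷ (0 ∷ 1 ∷ 2 ∷ []) ∷ (0 ∷ 0 ∷ 3 ∷ []) ∷ []

  extremal₄ : ∀ n → Extremal (3 + (n + 1)) 4
  extremal₄ = Family.extremal 9 4 O E P Q (from-yes (valid? 9 4 O E P Q))
    where
    O = 0 ∷ 1 ∷ 3 ∷ 7 ∷ []
    E = 5 ∷ []
    P = (0 ∷ 2 ∷ 0 ∷ 0 ∷ []) ∷ (0 ∷ 1 ∷ 1 ∷ 0 ∷ []) ∷ (0 ∷ 0 ∷ 2 ∷ 0 ∷ []) ∷ (0 ∷ 1 ∷ 0 ∷ 1 ∷ []) ∷ []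
    Q = (0 ∷ 3 ∷ 0 ∷ 0 ∷ []) ∷ (0 ∷ 2 ∷ 1 ∷ 0 ∷ []) ∷ (0 ∷ 1 ∷ 2 ∷ 0 ∷ []) ∷ (0 ∷ 0 ∷ 3 ∷ 0 ∷ [])
      ∷ (0 ∷ 2 ∷ 0 ∷ 1 ∷ []) ∷ []

  -- The product of the offsets 1 and 3 is not standard, as their sum 4 is an offset. The corners
  -- are the cubic monomials avoiding this product: four in the offsets 1 and 4, four in 3 and 4,
  -- one of them shared.
  extremal₅ : ∀ n → Extremal (3 + (n + 0)) 5
  extremal₅ = Family.extremal 9 5 O [] P Q (from-yes (valid? 9 5 O [] P Q))
    where
    O = 0 ∷ 1 ∷ 3 ∷ 4 ∷ []
    P = (0 ∷ 2 ∷ 0 ∷ 0 ∷ []) ∷ (0 ∷ 1 ∷ 0 ∷ 1 ∷ []) ∷ (0 ∷ 0 ∷ 2 ∷ 0 ∷ []) ∷ (0 ∷ 0 ∷ 1 ∷ 1 ∷ [])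
      ∷ (0 ∷ 0 ∷ 0 ∷ 2 ∷ []) ∷ []
    Q = (0 ∷ 3 ∷ 0 ∷ 0 ∷ []) ∷ (0 ∷ 2 ∷ 0 ∷ 1 ∷ []) ∷ (0 ∷ 1 ∷ 0 ∷ 2 ∷ []) ∷ (0 ∷ 0 ∷ 0 ∷ 3 ∷ [])
      ∷ (0 ∷ 0 ∷ 3 ∷ 0 ∷ []) ∷ (0 ∷ 0 ∷ 2 ∷ 1 ∷ []) ∷ (0 ∷ 0 ∷ 1 ∷ 2 ∷ []) ∷ []

-- The design for s = 4 has K = 9 and hence needs m ≥ 9, which excludes m = 8.
module Sporadic where
  g : Vec ℕ 4
  g = 8 ∷ 10 ∷ 11 ∷ 15 ∷ []

  -- The other four quadratic monomials without 8 are the only factorizations of their values 20,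
  -- 21, 22 and 25; the five cubic ones have all their quadratic divisors among these four.
  W : List (Vec ℕ 4)
  W = (0 ∷ 0 ∷ 1 ∷ 1 ∷ []) ∷ (0 ∷ 0 ∷ 0 ∷ 2 ∷ []) ∷ (0 ∷ 3 ∷ 0 ∷ 0 ∷ []) ∷ (0 ∷ 2 ∷ 1 ∷ 0 ∷ [])
    ∷ (0 ∷ 2 ∷ 0 ∷ 1 ∷ []) ∷ (0 ∷ 1 ∷ 2 ∷ 0 ∷ []) ∷ (0 ∷ 0 ∷ 3 ∷ 0 ∷ []) ∷ []

  g≥1 : ∀ i → 1 ≤ lookup g i
  g≥1 = from-yes (Fin.all? λ i → 1 ≤? lookup g i)

  abstract
    increasing : ∀ i j → i Fin.< j → lookup g i < lookup g j
    increasing = from-yes (Fin.all? λ i → Fin.all? λ j → (i Fin.<? j) →-dec (lookup g i <? lookup g j))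

    minimal : ∀ i → ¬ ∃ λ a → φ g a ≡ lookup g i × lookup a i ≡ 0
    minimal = from-yes (Fin.all? λ i → ¬? (factorization? g g≥1 (λ a → lookup a i ≟ 0) (lookup g i)))

    window : ∀ {t} → t < 8 → ∃ λ a → φ g a ≡ 18 + t × ⊤
    window = from-yes (allUpTo? (λ t → factorization? g g≥1 (λ _ → yes tt) (18 + t)) 8)

    isolated : All (λ w → ∀ i → lookup w i ≡ 0 ⊎
                          ¬ ∃ λ d → φ g d ≡ φ g (w [ i ]%= pred) × d ≢ w [ i ]%= pred) W
    isolated = from-yes (All.all? (λ w → Fin.all? λ i → (lookup w i ≟ 0) ⊎-dec
      ¬? (factorization? g g≥1 (λ d → ¬? (d ≟ᵛ w [ i ]%= pred)) (φ g (w [ i ]%= pred)))) W)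

    rooted : All (λ w → ∃ λ b → φ g b ≡ φ g w × b ∉ W) W
    rooted = from-yes (All.all? (λ w → factorization? g g≥1 (λ b → ¬? (b ∈? W)) (φ g w)) W)

  minGen : IsMinGenNumMonoid g
  minGen = increasing , (λ i (a , a_i , eq) → minimal i (a , eq , a_i))
         , 18 , window⇒cofinite 18 (λ t<8 → let a , eq , _ = window t<8 in a , eq)

  W-isolated : ∀ {w} → w ∈ W → Isolated g w
  W-isolated w∈ i d refl d′ φd′ with All.lookup isolated w∈ i
  ... | inj₁ w_i≡0 = contradiction w_i≡0 (lookup-unit⊕≢0 i d)
  ... | inj₂ none with d′ ≟ᵛ d
  ...   | yes d′≡d = d′≡d
  ...   | no d′≢d  = contradiction
    (d′ , ≡.trans φd′ (cong (φ g) (≡.sym (decrement-unit⊕ i d))) , λ eq → d′≢d (≡.trans eq (decrement-unit⊕ i d))) none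

  extremal : Extremal 3 4
  extremal = g , minGen , refl , λ R pres →
    +-monoˡ-≤ 4 (isolated≤presentation W (from-yes (unique? _≟ᵛ_ W)) W-isolated (All.lookup rooted) R pres)

-- The maximum, and Macaulay expansions in degree 2

every-extremal : ∀ e s → 3 ≤ e → s ≤ 5 → Extremal e s
every-extremal e s 3≤e s≤5 with n , refl ← m≤n⇒∃[o]m+o≡n 3≤e = go s n s≤5
  where
  go : ∀ s n → s ≤ 5 → Extremal (3 + n) s
  go 0 n       _ = subst (λ x → Extremal x 0) (+-identityʳ (3 + n)) (extremal₀ (3 + n))
  go 1 n       _ = subst (λ x → Extremal (1 + x) 1) (+-identityʳ (2 + n)) (extremal₁ (2 + n))
  go 2 n       _ = subst (λ x → Extremal (2 + x) 2) (+-identityʳ (1 + n)) (extremal₂ (1 + n))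
  go 3 n       _ = subst (λ x → Extremal (2 + x) 3) (+-comm n 1) (extremal₃ n)
  go 4 zero    _ = Sporadic.extremal
  go 4 (suc n) _ = subst (λ x → Extremal (3 + x) 4) (+-comm n 1) (extremal₄ n)
  go 5 n       _ = subst (λ x → Extremal (3 + x) 5) (+-identityʳ n) (extremal₅ n)
  go (suc (suc (suc (suc (suc (suc _)))))) n (s≤s (s≤s (s≤s (s≤s (s≤s ())))))

-- For the extremal `g` the two bounds meet, which determines its number of relations; for any other
-- monoid the upper bound suffices.
isMaxRho : ∀ e s → 3 ≤ e → s ≤ 5 → IsMaxRho e (suc (e + s)) (suc e C 2 + F s ∸ s)
isMaxRho e s 3≤e s≤5 with g , minGen , head≡ , lower ← every-extremal e s 3≤e s≤5
                     with R , pres , upper ← presentation≤ s g minGen head≡ s≤5 =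
  (g , minGen , head≡ , (R , pres , ≤-antisym (m+n≤o⇒m≤o∸n (length R) upper) (lower′ R pres)) , lower′) , maximal
  where
  lower′ : ∀ R → IsPresentation g R → suc e C 2 + F s ∸ s ≤ length R
  lower′ R pres = ≤-trans (∸-monoˡ-≤ s (lower R pres)) (≤-reflexive (m+n∸n≡m (length R) s))
  maximal : ∀ h → IsMinGenNumMonoid h → Vec.head h ≡ suc (e + s) → ∀ n → HasRho h n → n ≤ suc e C 2 + F s ∸ s
  maximal h minGen head≡ n (_ , n≤) with R , pres , upper ← presentation≤ s h minGen head≡ s≤5 =
    ≤-trans (n≤ R pres) (m+n≤o⇒m≤o∸n (length R) upper)

-- Excludes entries from 4 on in expansions of numbers up to 5, and gives the base case of
-- `large-binomial`.
6≤nC2 : ∀ x → 4 ≤ x → 6 ≤ x C 2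
6≤nC2 x 4≤x with y , refl ← m≤n⇒∃[o]m+o≡n 4≤x = go y
  where
  go : ∀ y → 6 ≤ (4 + y) C 2
  go zero    = ≤-refl
  go (suc y) = ≤-trans (go y) (≤-trans (m≤n+m _ ((4 + y) C 1)) (≤-reflexive (nCk+nC[k+1]≡[n+1]C[k+1] (4 + y) 1)))

-- Excludes `r ≥ 3` in the theorem. The case `j = 0` is Pascal's rule with `6≤nC2`, and Pascal's
-- rule also shows growth in `j`.
large-binomial : ∀ e j → 3 ≤ e → e + 6 < (e + (2 + j)) C (2 + j)
large-binomial e zero 3≤e = begin-strict
  e + 6                          <⟨ n<1+n (e + 6) ⟩
  suc e + 6                      ≤⟨ +-monoʳ-≤ (suc e) (6≤nC2 (suc e) (s≤s 3≤e)) ⟩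
  suc e + suc e C 2              ≡⟨ cong (_+ suc e C 2) (nC1≡n (suc e)) ⟨
  suc e C 1 + suc e C 2          ≡⟨ nCk+nC[k+1]≡[n+1]C[k+1] (suc e) 1 ⟩
  suc (suc e) C 2                ≡⟨ cong (_C 2) (+-comm e 2) ⟨
  (e + 2) C 2                    ∎
  where open ≤-Reasoning
large-binomial e (suc j) 3≤e = begin-strict
  e + 6                                                    <⟨ large-binomial e j 3≤e ⟩
  (e + (2 + j)) C (2 + j)                                  ≤⟨ m≤m+n _ _ ⟩
  (e + (2 + j)) C (2 + j) + (e + (2 + j)) C (3 + j)        ≡⟨ nCk+nC[k+1]≡[n+1]C[k+1] (e + (2 + j)) (2 + j) ⟩
  suc (e + (2 + j)) C (3 + j)                              ≡⟨ cong (_C (3 + j)) (+-suc e (2 + j)) ⟨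
  (e + (3 + j)) C (3 + j)                                  ∎
  where open ≤-Reasoning

-- A third entry would have degree 0, and a first entry of 4 or more contributes at least 6. Five
-- nonempty expansions remain, each settled by evaluation.
MacUp₂-unique : ∀ s {v} → s ≤ 5 → MacUp 2 s v → v ≡ F s
MacUp₂-unique s s≤5 ([] , _ , refl , refl) = refl
MacUp₂-unique s s≤5 (x ∷ [] , (_ , 2≤x , _) , refl , refl) = go x 2≤x s≤5
  where
  go : ∀ x → 2 ≤ x → x C 2 + 0 ≤ 5 → suc x C 3 + 0 ≡ F (x C 2 + 0)
  go 2 _ _ = refl
  go 3 _ _ = refl
  go (suc (suc (suc (suc y)))) _ ≤5 = contradiction (≤-trans (6≤nC2 (4 + y) (m≤m+n 4 y)) (≤-trans (m≤m+n _ 0) ≤5)) 1+n≰n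
  go 1 (s≤s ()) _
MacUp₂-unique s s≤5 (x ∷ y ∷ [] , (_ , 2≤x , y<x , _ , 1≤y , _) , refl , refl) = go x y 2≤x y<x 1≤y s≤5
  where
  go : ∀ x y → 2 ≤ x → y < x → 1 ≤ y → x C 2 + (y C 1 + 0) ≤ 5 → suc x C 3 + (suc y C 2 + 0) ≡ F (x C 2 + (y C 1 + 0))
  go 2 1 _ _ _ _ = refl
  go 3 1 _ _ _ _ = refl
  go 3 2 _ _ _ _ = refl
  go 1 _ (s≤s ()) _ _ _
  go 2 (suc (suc y)) _ (s≤s (s≤s ())) _ _
  go 3 (suc (suc (suc y))) _ (s≤s (s≤s (s≤s ()))) _ _
  go (suc (suc (suc (suc x)))) y _ _ _ ≤5 = contradiction (≤-trans (6≤nC2 (4 + x) (m≤m+n 4 x)) (≤-trans (m≤m+n _ (y C 1 + 0)) ≤5)) 1+n≰n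
MacUp₂-unique s s≤5 (x ∷ y ∷ z ∷ _ , (_ , _ , _ , _ , _ , _ , () , _) , _)

theorem3p3 : ∀ (e m : ℕ) → 3 ≤ e → e < m → m ∸ e ≤ 6 →
    ∀ (r : ℕ) → (e + r ∸ 1) C (r ∸ 1) ≤ m → m < (e + r) C r →
    ∀ (v : ℕ) → MacUp r (m ∸ (e + r ∸ 1) C (r ∸ 1)) v →
    IsMaxRho e m ((e + r ∸ 1) C r + v ∸ (m ∸ (e + r ∸ 1) C (r ∸ 1)))
theorem3p3 e m 3≤e e<m m∸e≤6 0 _ m<1 v _ = contradiction (≤-trans (s≤s z≤n) e<m) (<⇒≱ m<1)
theorem3p3 e m 3≤e e<m m∸e≤6 1 _ m<e+1 v _ = contradiction e<m (<⇒≱ (≤-trans m<e+1 (≤-reflexive (≡.trans (nC1≡n (e + 1)) (+-comm e 1)))))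
-- The only case that occurs: the lower binomial coefficient is `e + 1`, so the excess is
-- `m - e - 1`, at most 5.
theorem3p3 e m 3≤e e<m m∸e≤6 2 _ _ v mac with s , refl ← m≤n⇒∃[o]m+o≡n e<m =
  subst (IsMaxRho e (suc (e + s))) value (isMaxRho e s 3≤e s≤5)
  where
  e+2∸1 : e + 2 ∸ 1 ≡ suc e
  e+2∸1 = cong (_∸ 1) (+-comm e 2)
  excess : suc (e + s) ∸ (e + 2 ∸ 1) C 1 ≡ s
  excess = ≡.trans (cong (suc (e + s) ∸_) (≡.trans (nC1≡n (e + 2 ∸ 1)) e+2∸1)) (m+n∸m≡n (suc e) s)
  s≤5 : s ≤ 5
  s≤5 = s≤s⁻¹ (≤-trans (≤-reflexive (≡.sym (≡.trans (cong (_∸ e) (≡.sym (+-suc e s))) (m+n∸m≡n e (suc s))))) m∸e≤6)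
  value : suc e C 2 + F s ∸ s ≡ (e + 2 ∸ 1) C 2 + v ∸ (suc (e + s) ∸ (e + 2 ∸ 1) C 1)
  value = cong₂ _∸_
    (cong₂ _+_ (cong (_C 2) (≡.sym e+2∸1)) (≡.sym (MacUp₂-unique s s≤5 (subst (λ x → MacUp 2 x v) excess mac))))
    (≡.sym excess)
-- The lower binomial coefficient would exceed `e + 6`, but `m` does not.
theorem3p3 e m 3≤e e<m m∸e≤6 (suc (suc (suc j))) ≤m _ v _ = contradiction
  (≤-trans (large-binomial e j 3≤e) (≤-trans (≤-reflexive (cong (_C (2 + j)) (≡.sym (cong (_∸ 1) (+-suc e (2 + j)))))) ≤m))
  (≤⇒≯ (≤-trans (m≤n+m∸n m e) (+-monoʳ-≤ e m∸e≤6)))
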